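{- Let $a,b,c$ be complex numbers and let $(g(x),xg(x))$ be the Bell pseudo-involution whose $B$-sequence has generating function $$B(x)=\frac{a-cx}{1+bx}.$$ Let $A(x)$ be the generating function of the $A$-sequence of $(g(x),xg(x))$. Then, as formal power series, $$A(x)=1+ax-\frac{x^3(ab+c)}{1+ax+bx^2}\, C\left(\frac{x^3(ab+c)}{(1+ax+bx^2)^2}\right)$$ and $$g(x)=\frac{1}{1-ax-bx^2}\,C\left(\frac{ -x^2(b+cx)}{(1-ax-bx^2)^2}\right),$$ where $C(x)=\frac{1-\sqrt{1-4x}}{2x}=\sum_{n\ge 0}\frac{1}{n+1}\binom{2n}{n}x^n$ is the generating function of the Catalan numbers.
   Context: All power series are formal, with complex coefficients. The symbol $c$ is a scalar parameter; $C(\cdot)$ is the Catalan generating function. Riordan arrays: for $g(x)=1+g_1x+\cdots$ and $f(x)=f_1x+f_2x^2+\cdots$ with $f_1\neq 0$, the Riordan array $(g(x),f(x))$ is the infinite lower triangular matrix with entries $t_{n,k}=[x^n]\,g(x)f(x)^k$, $n,k\ge 0$. The product of Riordan arrays is $(g,f)\cdot(u,v)=(g(x)u(f(x)),v(f(x)))$, and the identity is $(1,x)$. A Bell array is a Riordan array of the form $(g(x),xg(x))$ with $g(0)=1$. It is a Bell pseudo-involution if $(g(x),-xg(x))^2=(1,x)$. $A$-sequence: the generating function of the $A$-sequence of $(g(x),f(x))$ is $A(x)=x/\bar f(x)$, where $\bar f$ is the compositional inverse of $f$; here $f(x)=xg(x)$. $B$-sequence: the $B$-sequence of a Bell pseudo-involution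 $(g(x),xg(x))$ with entries $t_{n,k}$ is the sequence $b_0,b_1,b_2,\ldots$ such that, for all $n,k\ge 0$, $$t_{n+1,k}=t_{n,k-1}+\sum_{j\ge 0} b_j\, t_{n-j,k+j},$$ where $t_{n,-1}=0$ and $t_{m,l}=0$ whenever $m<0$ or $l>m$. Its generating function is $B(x)=\sum_{j\ge0} b_jx^j$. -}

module Defs where

open import Algebra.Bundles using (CommutativeRing)
open import Data.Nat.Base as ℕ using (ℕ; zero; suc; _∸_)
import Data.Nat.Properties as ℕₚ
open import Data.Nat.Combinatorics using (_C_)
import Data.Nat.DivMod as ℕ
open import Data.Fin.Base using (toℕ)
open import Data.Product.Base using (_×_; _,_; ∃-syntax; Σ-syntax)
open import Data.Rational.Base as ℚ using (ℚ; 0ℚ; 1ℚ; ½; ∣_∣)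
import Data.Rational.Properties as ℚₚ
import Data.Rational.Solver as ℚ-Solver
open import Level using (0ℓ; _⊔_)
open import Relation.Binary.Structures using (IsEquivalence)
open import Relation.Binary.PropositionalEquality as ≡ using (_≡_)

private
  module Identities {c ℓ} (R : CommutativeRing c ℓ) where

    open CommutativeRing R
    open import Algebra.Properties.Ring ring
      using (-1*x≈-x; x[y-z]≈xy-xz; [y-z]x≈yx-zx; -‿+-comm; -‿involutive)
    open import Algebra.Properties.CommutativeSemigroup +-commutativeSemigroup
      using (interchange)
    open import Relation.Binary.Reasoning.Setoid setoid
    open import Algebra.Solver.Ring.NaturalCoefficients.Default commutativeSemiring
      using (solve; _:+_; _:*_; _:=_)

    neg-minus : ∀ p q → - (p - q) ≈ - p - - q
    neg-minus p q = sym (-‿+-comm p (- q))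

    plus-minus : ∀ p q r s → (p + q) - (r + s) ≈ (p - r) + (q - s)
    plus-minus p q r s = trans (+-congˡ (sym (-‿+-comm r s))) (interchange p q (- r) (- s))

    swap-minus : ∀ p q → p - q ≈ - (q - p)
    swap-minus p q = begin
      p - q       ≈⟨ +-comm p (- q) ⟩
      - q + p     ≈⟨ +-congˡ (-‿involutive p) ⟨
      - q - - p   ≈⟨ neg-minus q p ⟨
      - (q - p)   ∎

    telescope : ∀ p q r → (p - q) + (q - r) ≈ p - r
    telescope p q r = begin
      (p - q) + (q - r)     ≈⟨ +-assoc p (- q) (q - r) ⟩
      p + (- q + (q - r))   ≈⟨ +-congˡ (+-assoc (- q) q (- r)) ⟨
      p + ((- q + q) - r)   ≈⟨ +-congˡ (+-congʳ (-‿inverseˡ q)) ⟩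
      p + (0# - r)          ≈⟨ +-congˡ (+-identityˡ (- r)) ⟩
      p - r                 ∎

    add-back : ∀ p q → p ≈ q + (p - q)
    add-back p q = begin
      p               ≈⟨ +-identityʳ p ⟨
      p + 0#          ≈⟨ +-congˡ (-‿inverseˡ q) ⟨
      p + (- q + q)   ≈⟨ +-assoc p (- q) q ⟨
      (p - q) + q     ≈⟨ +-comm (p - q) q ⟩
      q + (p - q)     ∎

    times-minus : ∀ p q r s → p * q - r * s ≈ p * (q - s) + (p - r) * s
    times-minus p q r s = begin
      p * q - r * s                       ≈⟨ telescope (p * q) (p * s) (r * s) ⟨
      (p * q - p * s) + (p * s - r * s)   ≈⟨ +-cong (x[y-z]≈xy-xz p q s) ([y-z]x≈yx-zx s p r) ⟨
      p * (q - s) + (p - r) * s           ∎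

    private
      neg : ∀ x → - x ≈ - 1# * x
      neg x = sym (-1*x≈-x x)

    assoc-re : ∀ a b c d e f → (a * c - b * d) * e - (a * d + b * c) * f ≈
                               a * (c * e - d * f) - b * (c * f + d * e)
    assoc-re a b c d e f = begin
      (a * c - b * d) * e - (a * d + b * c) * f
        ≈⟨ +-cong (*-congʳ (+-congˡ (neg _))) (neg _) ⟩
      (a * c + - 1# * (b * d)) * e + - 1# * ((a * d + b * c) * f)
        ≈⟨ solve 7 (λ a b c d e f n →
             (a :* c :+ n :* (b :* d)) :* e :+ n :* ((a :* d :+ b :* c) :* f) :=
             a :* (c :* e :+ n :* (d :* f)) :+ n :* (b :* (c :* f :+ d :* e)))
             refl a b c d e f (- 1#) ⟩
      a * (c * e + - 1# * (d * f)) + - 1# * (b * (c * f + d * e))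
        ≈⟨ +-cong (*-congˡ (+-congˡ (neg _))) (neg _) ⟨
      a * (c * e - d * f) - b * (c * f + d * e) ∎

    assoc-im : ∀ a b c d e f → (a * c - b * d) * f + (a * d + b * c) * e ≈
                               a * (c * f + d * e) + b * (c * e - d * f)
    assoc-im a b c d e f = begin
      (a * c - b * d) * f + (a * d + b * c) * e
        ≈⟨ +-congʳ (*-congʳ (+-congˡ (neg _))) ⟩
      (a * c + - 1# * (b * d)) * f + (a * d + b * c) * e
        ≈⟨ solve 7 (λ a b c d e f n →
             (a :* c :+ n :* (b :* d)) :* f :+ (a :* d :+ b :* c) :* e :=
             a :* (c :* f :+ d :* e) :+ b :* (c :* e :+ n :* (d :* f)))
             refl a b c d e f (- 1#) ⟩
      a * (c * f + d * e) + b * (c * e + - 1# * (d * f))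
        ≈⟨ +-congˡ (*-congˡ (+-congˡ (neg _))) ⟨
      a * (c * f + d * e) + b * (c * e - d * f) ∎

    distrib-re : ∀ a b c d e f → a * (c + e) - b * (d + f) ≈ (a * c - b * d) + (a * e - b * f)
    distrib-re a b c d e f = trans
      (+-cong (distribˡ a c e) (-‿cong (distribˡ b d f))) (plus-minus _ _ _ _)

    distrib-im : ∀ a b c d e f → a * (d + f) + b * (c + e) ≈ (a * d + b * c) + (a * f + b * e)
    distrib-im a b c d e f = trans
      (+-cong (distribˡ a d f) (distribˡ b c e)) (interchange _ _ _ _)

module Real where

  Eventually : (ℕ → Set) → Set
  Eventually P = ∃[ N ] (∀ n → N ℕ.≤ n → P n)

  Eventually₂ : (ℕ → ℕ → Set) → Set
  Eventually₂ P = ∃[ N ] (∀ m n → N ℕ.≤ m → N ℕ.≤ n → P m n)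

  IsCauchy : (ℕ → ℚ) → Set
  IsCauchy x = ∀ ε → 0ℚ ℚ.< ε → Eventually₂ λ m n → ∣ x m ℚ.- x n ∣ ℚ.≤ ε

  record ℝ : Set where
    constructor mkℝ
    field
      seq    : ℕ → ℚ
      cauchy : IsCauchy seq

  open ℝ public

  infix 4 _≈_

  -- A record rather than a function, so that x and y can be inferred.
  record _≈_ (x y : ℝ) : Set where
    constructor mk≈
    field
      close : ∀ ε → 0ℚ ℚ.< ε → Eventually λ n → ∣ seq x n ℚ.- seq y n ∣ ℚ.≤ ε

  open _≈_ public

  private
    module I = Identities ℚₚ.+-*-commutativeRing

    ∣p-p∣≤ : ∀ p {ε} → 0ℚ ℚ.< ε → ∣ p ℚ.- p ∣ ℚ.≤ ε
    ∣p-p∣≤ p 0<ε rewrite ℚₚ.+-inverseʳ p = ℚₚ.<⇒≤ 0<ε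

    ∣p-q∣≡∣q-p∣ : ∀ p q → ∣ p ℚ.- q ∣ ≡ ∣ q ℚ.- p ∣
    ∣p-q∣≡∣q-p∣ p q = ≡.trans
      (≡.cong ∣_∣ (I.swap-minus p q))
      (ℚₚ.∣-p∣≡∣p∣ (q ℚ.- p))

    0<½* : ∀ {ε} → 0ℚ ℚ.< ε → 0ℚ ℚ.< ½ ℚ.* ε
    0<½* = ℚₚ.*-monoʳ-<-pos ½

    halves : ∀ ε → ½ ℚ.* ε ℚ.+ ½ ℚ.* ε ≡ ε
    halves ε = ≡.trans (≡.sym (ℚₚ.*-distribʳ-+ ε ½ ½)) (ℚₚ.*-identityˡ ε)

    open ℚₚ.≤-Reasoning

    +-bound : ∀ p q r s {ε} → ∣ p ℚ.- r ∣ ℚ.≤ ½ ℚ.* ε → ∣ q ℚ.- s ∣ ℚ.≤ ½ ℚ.* ε →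
              ∣ (p ℚ.+ q) ℚ.- (r ℚ.+ s) ∣ ℚ.≤ ε
    +-bound p q r s {ε} h k = begin
      ∣ (p ℚ.+ q) ℚ.- (r ℚ.+ s) ∣       ≡⟨ ≡.cong ∣_∣ (I.plus-minus p q r s) ⟩
      ∣ (p ℚ.- r) ℚ.+ (q ℚ.- s) ∣       ≤⟨ ℚₚ.∣p+q∣≤∣p∣+∣q∣ (p ℚ.- r) (q ℚ.- s) ⟩
      ∣ p ℚ.- r ∣ ℚ.+ ∣ q ℚ.- s ∣       ≤⟨ ℚₚ.+-mono-≤ h k ⟩
      ½ ℚ.* ε ℚ.+ ½ ℚ.* ε               ≡⟨ halves ε ⟩
      ε                                 ∎

    trans-bound : ∀ p q r {ε} → ∣ p ℚ.- q ∣ ℚ.≤ ½ ℚ.* ε → ∣ q ℚ.- r ∣ ℚ.≤ ½ ℚ.* ε →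
                  ∣ p ℚ.- r ∣ ℚ.≤ ε
    trans-bound p q r {ε} h k = begin
      ∣ p ℚ.- r ∣                       ≡⟨ ≡.cong ∣_∣ (I.telescope p q r) ⟨
      ∣ (p ℚ.- q) ℚ.+ (q ℚ.- r) ∣       ≤⟨ ℚₚ.∣p+q∣≤∣p∣+∣q∣ (p ℚ.- q) (q ℚ.- r) ⟩
      ∣ p ℚ.- q ∣ ℚ.+ ∣ q ℚ.- r ∣       ≤⟨ ℚₚ.+-mono-≤ h k ⟩
      ½ ℚ.* ε ℚ.+ ½ ℚ.* ε               ≡⟨ halves ε ⟩
      ε                                 ∎

    neg-bound : ∀ p q {ε} → ∣ p ℚ.- q ∣ ℚ.≤ ε → ∣ ℚ.- p ℚ.- ℚ.- q ∣ ℚ.≤ ε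
    neg-bound p q {ε} h = ≡.subst (ℚ._≤ ε) (≡.trans (≡.sym (ℚₚ.∣-p∣≡∣p∣ (p ℚ.- q)))
      (≡.cong ∣_∣ (I.neg-minus p q))) h

    *-mono : ∀ {p q r s} → 0ℚ ℚ.≤ r → 0ℚ ℚ.≤ q → p ℚ.≤ q → r ℚ.≤ s → p ℚ.* r ℚ.≤ q ℚ.* s
    *-mono {p} {q} {r} {s} 0≤r 0≤q h k = ℚₚ.≤-trans
      (ℚₚ.*-monoʳ-≤-nonNeg r {{ℚ.nonNegative 0≤r}} h)
      (ℚₚ.*-monoˡ-≤-nonNeg q {{ℚ.nonNegative 0≤q}} k)

    *-bound : ∀ p q r s {K L δ η ε} → 0ℚ ℚ.< K → 0ℚ ℚ.< δ →
              ∣ p ∣ ℚ.≤ K → ∣ s ∣ ℚ.≤ L → ∣ q ℚ.- s ∣ ℚ.≤ η → ∣ p ℚ.- r ∣ ℚ.≤ δ →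
              K ℚ.* η ≡ ½ ℚ.* ε → δ ℚ.* L ≡ ½ ℚ.* ε →
              ∣ p ℚ.* q ℚ.- r ℚ.* s ∣ ℚ.≤ ε
    *-bound p q r s {K} {L} {δ} {η} {ε} 0<K 0<δ h₁ h₂ h₃ h₄ e₁ e₂ = begin
      ∣ p ℚ.* q ℚ.- r ℚ.* s ∣           ≡⟨ ≡.cong ∣_∣ (I.times-minus p q r s) ⟩
      ∣ p ℚ.* (q ℚ.- s) ℚ.+ (p ℚ.- r) ℚ.* s ∣
        ≤⟨ ℚₚ.∣p+q∣≤∣p∣+∣q∣ (p ℚ.* (q ℚ.- s)) ((p ℚ.- r) ℚ.* s) ⟩
      ∣ p ℚ.* (q ℚ.- s) ∣ ℚ.+ ∣ (p ℚ.- r) ℚ.* s ∣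
        ≡⟨ ≡.cong₂ ℚ._+_ (ℚₚ.∣p*q∣≡∣p∣*∣q∣ p (q ℚ.- s)) (ℚₚ.∣p*q∣≡∣p∣*∣q∣ (p ℚ.- r) s) ⟩
      ∣ p ∣ ℚ.* ∣ q ℚ.- s ∣ ℚ.+ ∣ p ℚ.- r ∣ ℚ.* ∣ s ∣
        ≤⟨ ℚₚ.+-mono-≤ (*-mono (ℚₚ.0≤∣p∣ (q ℚ.- s)) (ℚₚ.<⇒≤ 0<K) h₁ h₃)
                       (*-mono (ℚₚ.0≤∣p∣ s) (ℚₚ.<⇒≤ 0<δ) h₄ h₂) ⟩
      K ℚ.* η ℚ.+ δ ℚ.* L               ≡⟨ ≡.cong₂ ℚ._+_ e₁ e₂ ⟩
      ½ ℚ.* ε ℚ.+ ½ ℚ.* ε               ≡⟨ halves ε ⟩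
      ε                                 ∎

    bounded : ∀ x → Σ[ K ∈ ℚ ] 0ℚ ℚ.< K × Eventually λ n → ∣ seq x n ∣ ℚ.≤ K
    bounded x with cauchy x 1ℚ (ℚₚ.positive⁻¹ 1ℚ)
    ... | N , h = K , ℚₚ.+-mono-≤-< (ℚₚ.0≤∣p∣ xN) (ℚₚ.positive⁻¹ 1ℚ) , N , λ n N≤n → begin
      ∣ seq x n ∣                 ≡⟨ ≡.cong ∣_∣ (I.add-back (seq x n) xN) ⟩
      ∣ xN ℚ.+ (seq x n ℚ.- xN) ∣ ≤⟨ ℚₚ.∣p+q∣≤∣p∣+∣q∣ xN (seq x n ℚ.- xN) ⟩
      ∣ xN ∣ ℚ.+ ∣ seq x n ℚ.- xN ∣ ≤⟨ ℚₚ.+-monoʳ-≤ ∣ xN ∣ (h n N N≤n ℕₚ.≤-refl) ⟩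
      K                           ∎
      where
      xN = seq x N
      K  = ∣ xN ∣ ℚ.+ 1ℚ

    share : ∀ K → 0ℚ ℚ.< K → ∀ ε → 0ℚ ℚ.< ε →
            Σ[ δ ∈ ℚ ] 0ℚ ℚ.< δ × K ℚ.* δ ≡ ½ ℚ.* ε × δ ℚ.* K ≡ ½ ℚ.* ε
    share K 0<K ε 0<ε = δ , 0<δ , Kδ , ≡.trans (ℚₚ.*-comm δ K) Kδ
      where
      instance
        K>0 = ℚ.positive 0<K
        K≢0 = ℚₚ.pos⇒nonZero K
        ½ε>0 = ℚ.positive (0<½* 0<ε)
        1/K>0 = ℚₚ.1/pos⇒pos K
      δ = ℚ.1/ K ℚ.* (½ ℚ.* ε)
      0<δ : 0ℚ ℚ.< δ
      0<δ = ℚₚ.positive⁻¹ δ {{ℚₚ.pos*pos⇒pos (ℚ.1/ K) (½ ℚ.* ε)}}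
      Kδ : K ℚ.* δ ≡ ½ ℚ.* ε
      Kδ = ≡.trans (≡.sym (ℚₚ.*-assoc K (ℚ.1/ K) (½ ℚ.* ε)))
             (≡.trans (≡.cong (ℚ._* (½ ℚ.* ε)) (ℚₚ.*-inverseʳ K)) (ℚₚ.*-identityˡ _))

    ⊔ˡ : ∀ {M N n} → M ℕ.⊔ N ℕ.≤ n → M ℕ.≤ n
    ⊔ˡ {M} {N} = ℕₚ.≤-trans (ℕₚ.m≤m⊔n M N)

    ⊔ʳ : ∀ {M N n} → M ℕ.⊔ N ℕ.≤ n → N ℕ.≤ n
    ⊔ʳ {M} {N} = ℕₚ.≤-trans (ℕₚ.m≤n⊔m M N)

  abstract

    const-cauchy : ∀ p → IsCauchy (λ _ → p)
    const-cauchy p ε 0<ε = 0 , λ _ _ _ _ → ∣p-p∣≤ p 0<ε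

    +-cauchy : ∀ x y → IsCauchy (λ n → seq x n ℚ.+ seq y n)
    +-cauchy x y ε 0<ε with cauchy x _ (0<½* 0<ε) | cauchy y _ (0<½* 0<ε)
    ... | M , h | N , k = M ℕ.⊔ N , λ m n hm hn →
      +-bound (seq x m) (seq y m) (seq x n) (seq y n)
        (h m n (⊔ˡ {M} {N} hm) (⊔ˡ {M} {N} hn)) (k m n (⊔ʳ {M} {N} hm) (⊔ʳ {M} {N} hn))

    neg-cauchy : ∀ x → IsCauchy (λ n → ℚ.- seq x n)
    neg-cauchy x ε 0<ε with cauchy x ε 0<ε
    ... | M , h = M , λ m n hm hn → neg-bound (seq x m) (seq x n) (h m n hm hn)

    *-cauchy : ∀ x y → IsCauchy (λ n → seq x n ℚ.* seq y n)
    *-cauchy x y ε 0<ε with bounded x | bounded y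
    ... | K , 0<K , N₁ , h₁ | L , 0<L , N₂ , h₂ with share K 0<K ε 0<ε | share L 0<L ε 0<ε
    ... | η , 0<η , Kη , _ | δ , 0<δ , _ , δL with cauchy x δ 0<δ | cauchy y η 0<η
    ... | N₃ , h₃ | N₄ , h₄ = (N₁ ℕ.⊔ N₂) ℕ.⊔ (N₃ ℕ.⊔ N₄) , λ m n hm hn →
      let m₁₂ = ⊔ˡ {N₁ ℕ.⊔ N₂} {N₃ ℕ.⊔ N₄} hm ; m₃₄ = ⊔ʳ {N₁ ℕ.⊔ N₂} {N₃ ℕ.⊔ N₄} hm
          n₁₂ = ⊔ˡ {N₁ ℕ.⊔ N₂} {N₃ ℕ.⊔ N₄} hn ; n₃₄ = ⊔ʳ {N₁ ℕ.⊔ N₂} {N₃ ℕ.⊔ N₄} hn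
      in *-bound (seq x m) (seq y m) (seq x n) (seq y n) 0<K 0<δ
           (h₁ m (⊔ˡ {N₁} {N₂} m₁₂)) (h₂ n (⊔ʳ {N₁} {N₂} n₁₂))
           (h₄ m n (⊔ʳ {N₃} {N₄} m₃₄) (⊔ʳ {N₃} {N₄} n₃₄))
           (h₃ m n (⊔ˡ {N₃} {N₄} m₃₄) (⊔ˡ {N₃} {N₄} n₃₄)) Kη δL

  infixl 6 _+_
  infixl 7 _*_
  infix  8 -_

  fromℚ : ℚ → ℝ
  fromℚ p = mkℝ (λ _ → p) (const-cauchy p)

  _+_ : ℝ → ℝ → ℝ
  x + y = mkℝ (λ n → seq x n ℚ.+ seq y n) (+-cauchy x y)

  _*_ : ℝ → ℝ → ℝ
  x * y = mkℝ (λ n → seq x n ℚ.* seq y n) (*-cauchy x y)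

  -_ : ℝ → ℝ
  - x = mkℝ (λ n → ℚ.- seq x n) (neg-cauchy x)

  abstract

    pointwise : ∀ {x y} → (∀ n → seq x n ≡ seq y n) → x ≈ y
    pointwise {x} {y} h = mk≈ λ ε 0<ε → 0 , λ n _ →
      ≡.subst (λ t → ∣ seq x n ℚ.- t ∣ ℚ.≤ ε) (h n) (∣p-p∣≤ (seq x n) 0<ε)

    ≈-isEquivalence : IsEquivalence _≈_
    ≈-isEquivalence = record
      { refl  = pointwise λ _ → ≡.refl
      ; sym   = λ {x} {y} x≈y → mk≈ λ ε 0<ε → let N , h = close x≈y ε 0<ε in
          N , λ n N≤n → ≡.subst (ℚ._≤ ε) (∣p-q∣≡∣q-p∣ (seq x n) (seq y n)) (h n N≤n)
      ; trans = λ {x} {y} {z} x≈y y≈z → mk≈ λ ε 0<ε →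
          let M , h = close x≈y _ (0<½* 0<ε)
              N , k = close y≈z _ (0<½* 0<ε)
          in M ℕ.⊔ N , λ n hn → trans-bound (seq x n) (seq y n) (seq z n)
               (h n (⊔ˡ {M} {N} hn)) (k n (⊔ʳ {M} {N} hn))
      }

    +-cong : ∀ {x x′ y y′} → x ≈ x′ → y ≈ y′ → x + y ≈ x′ + y′
    +-cong {x} {x′} {y} {y′} x≈x′ y≈y′ = mk≈ λ ε 0<ε →
      let M , h = close x≈x′ _ (0<½* 0<ε)
          N , k = close y≈y′ _ (0<½* 0<ε)
      in M ℕ.⊔ N , λ n hn → +-bound (seq x n) (seq y n) (seq x′ n) (seq y′ n)
           (h n (⊔ˡ {M} {N} hn)) (k n (⊔ʳ {M} {N} hn))

    -‿cong : ∀ {x y} → x ≈ y → - x ≈ - y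
    -‿cong {x} {y} x≈y = mk≈ λ ε 0<ε → let N , h = close x≈y ε 0<ε in
      N , λ n N≤n → neg-bound (seq x n) (seq y n) (h n N≤n)

    *-cong : ∀ {x x′ y y′} → x ≈ x′ → y ≈ y′ → x * y ≈ x′ * y′
    *-cong {x} {x′} {y} {y′} x≈x′ y≈y′ = mk≈ λ ε 0<ε →
      let K , 0<K , N₁ , h₁ = bounded x
          L , 0<L , N₂ , h₂ = bounded y′
          η , 0<η , Kη , _  = share K 0<K ε 0<ε
          δ , 0<δ , _ , δL  = share L 0<L ε 0<ε
          N₃ , h₃ = close x≈x′ δ 0<δ
          N₄ , h₄ = close y≈y′ η 0<η
      in (N₁ ℕ.⊔ N₂) ℕ.⊔ (N₃ ℕ.⊔ N₄) , λ n hn →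
        let n₁₂ = ⊔ˡ {N₁ ℕ.⊔ N₂} {N₃ ℕ.⊔ N₄} hn
            n₃₄ = ⊔ʳ {N₁ ℕ.⊔ N₂} {N₃ ℕ.⊔ N₄} hn
        in *-bound (seq x n) (seq y n) (seq x′ n) (seq y′ n) 0<K 0<δ
             (h₁ n (⊔ˡ {N₁} {N₂} n₁₂)) (h₂ n (⊔ʳ {N₁} {N₂} n₁₂))
             (h₄ n (⊔ʳ {N₃} {N₄} n₃₄)) (h₃ n (⊔ˡ {N₃} {N₄} n₃₄)) Kη δL

  commutativeRing : CommutativeRing 0ℓ 0ℓ
  commutativeRing = record
    { Carrier = ℝ ; _≈_ = _≈_ ; _+_ = _+_ ; _*_ = _*_ ; -_ = -_
    ; 0# = fromℚ 0ℚ ; 1# = fromℚ 1ℚ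
    ; isCommutativeRing = record
      { isRing = record
        { +-isAbelianGroup = record
          { isGroup = record
            { isMonoid = record
              { isSemigroup = record
                { isMagma = record { isEquivalence = ≈-isEquivalence ; ∙-cong = +-cong }
                ; assoc = λ x y z → pointwise λ n → ℚₚ.+-assoc (seq x n) (seq y n) (seq z n)
                }
              ; identity = (λ x → pointwise λ n → ℚₚ.+-identityˡ (seq x n))
                         , (λ x → pointwise λ n → ℚₚ.+-identityʳ (seq x n))
              }
            ; inverse = (λ x → pointwise λ n → ℚₚ.+-inverseˡ (seq x n))
                      , (λ x → pointwise λ n → ℚₚ.+-inverseʳ (seq x n))
            ; ⁻¹-cong = -‿cong
            }
          ; comm = λ x y → pointwise λ n → ℚₚ.+-comm (seq x n) (seq y n)
          }
        ; *-cong = *-cong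
        ; *-assoc = λ x y z → pointwise λ n → ℚₚ.*-assoc (seq x n) (seq y n) (seq z n)
        ; *-identity = (λ x → pointwise λ n → ℚₚ.*-identityˡ (seq x n))
                     , (λ x → pointwise λ n → ℚₚ.*-identityʳ (seq x n))
        ; distrib = (λ x y z → pointwise λ n → ℚₚ.*-distribˡ-+ (seq x n) (seq y n) (seq z n))
                  , (λ x y z → pointwise λ n → ℚₚ.*-distribʳ-+ (seq x n) (seq y n) (seq z n))
        }
      ; *-comm = λ x y → pointwise λ n → ℚₚ.*-comm (seq x n) (seq y n)
      }
    }

open Real using (ℝ)

infixl 6 _+i_

record ℂ : Set where
  constructor _+i_
  field
    re im : ℝ

module Complex where

  open ℂ
  private
    module R = CommutativeRing Real.commutativeRing
    module I = Identities Real.commutativeRing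

  infix  4 _≈_
  infixl 6 _+_
  infixl 7 _*_
  infix  8 -_

  record _≈_ (z w : ℂ) : Set where
    constructor _,_
    field
      re≈ : re z R.≈ re w
      im≈ : im z R.≈ im w

  _+_ : ℂ → ℂ → ℂ
  z + w = (re z R.+ re w) +i (im z R.+ im w)

  _*_ : ℂ → ℂ → ℂ
  z * w = (re z R.* re w R.- im z R.* im w) +i (re z R.* im w R.+ im z R.* re w)

  -_ : ℂ → ℂ
  - z = (R.- re z) +i (R.- im z)

  0ℂ 1ℂ : ℂ
  0ℂ = R.0# +i R.0#
  1ℂ = R.1# +i R.0#

  abstract

    ≈-isEquivalence : IsEquivalence _≈_
    ≈-isEquivalence = record
      { refl  = R.refl , R.refl
      ; sym   = λ (p , q) → R.sym p , R.sym q
      ; trans = λ (p , q) (r , s) → R.trans p r , R.trans q s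
      }

    *-cong : ∀ {z z′ w w′} → z ≈ z′ → w ≈ w′ → z * w ≈ z′ * w′
    *-cong (p , q) (r , s) =
        R.+-cong (R.*-cong p r) (R.-‿cong (R.*-cong q s))
      , R.+-cong (R.*-cong p s) (R.*-cong q r)

    *-comm : ∀ z w → z * w ≈ w * z
    *-comm (a +i b) (c +i d) =
        R.+-cong (R.*-comm a c) (R.-‿cong (R.*-comm b d))
      , R.trans (R.+-comm _ _) (R.+-cong (R.*-comm b c) (R.*-comm a d))

    *-identityˡ : ∀ z → 1ℂ * z ≈ z
    *-identityˡ (a +i b) =
        R.trans (R.+-cong (R.*-identityˡ a) (R.-‿cong (R.zeroˡ b)))
          (R.trans (R.+-congˡ (R.trans (R.sym (R.+-identityˡ _)) (R.-‿inverseʳ R.0#)))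
            (R.+-identityʳ a))
      , R.trans (R.+-cong (R.*-identityˡ b) (R.zeroˡ a)) (R.+-identityʳ b)

    *-assoc : ∀ z w v → (z * w) * v ≈ z * (w * v)
    *-assoc (a +i b) (c +i d) (e +i f) = I.assoc-re a b c d e f , I.assoc-im a b c d e f

    *-distribˡ-+ : ∀ z w v → z * (w + v) ≈ z * w + z * v
    *-distribˡ-+ (a +i b) (c +i d) (e +i f) = I.distrib-re a b c d e f , I.distrib-im a b c d e f

  commutativeRing : CommutativeRing 0ℓ 0ℓ
  commutativeRing = record
    { Carrier = ℂ ; _≈_ = _≈_ ; _+_ = _+_ ; _*_ = _*_ ; -_ = -_ ; 0# = 0ℂ ; 1# = 1ℂ
    ; isCommutativeRing = record
      { isRing = record
        { +-isAbelianGroup = record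
          { isGroup = record
            { isMonoid = record
              { isSemigroup = record
                { isMagma = record
                  { isEquivalence = ≈-isEquivalence
                  ; ∙-cong = λ (p , q) (r , s) → R.+-cong p r , R.+-cong q s
                  }
                ; assoc = λ z w v → R.+-assoc _ _ _ , R.+-assoc _ _ _
                }
              ; identity = (λ z → R.+-identityˡ _ , R.+-identityˡ _)
                         , (λ z → R.+-identityʳ _ , R.+-identityʳ _)
              }
            ; inverse = (λ z → R.-‿inverseˡ _ , R.-‿inverseˡ _)
                      , (λ z → R.-‿inverseʳ _ , R.-‿inverseʳ _)
            ; ⁻¹-cong = λ (p , q) → R.-‿cong p , R.-‿cong q
            }
          ; comm = λ z w → R.+-comm _ _ , R.+-comm _ _
          }
        ; *-cong = *-cong
        ; *-assoc = *-assoc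
        ; *-identity = *-identityˡ
                     , (λ z → ≈.trans (*-comm z 1ℂ) (*-identityˡ z))
        ; distrib = *-distribˡ-+
                  , (λ z w v → ≈.trans (*-comm (w + v) z) (≈.trans (*-distribˡ-+ z w v)
                      (+-cong (*-comm z w) (*-comm z v))))
        }
      ; *-comm = *-comm
      }
    }
    where
    module ≈ = IsEquivalence ≈-isEquivalence
    +-cong : ∀ {z z′ w w′} → z ≈ z′ → w ≈ w′ → z + w ≈ z′ + w′
    +-cong (p , q) (r , s) = R.+-cong p r , R.+-cong q s

module FormalPowerSeries {c ℓ} (R : CommutativeRing c ℓ) where

  private
    module R = CommutativeRing R
  open import Algebra.Properties.Monoid.Sum R.+-monoid using (sum⁺-syntax)
  open import Algebra.Definitions.RawMonoid R.+-rawMonoid using () renaming (_×_ to _×#_)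

  Series : Set c
  Series = ℕ → R.Carrier

  infix  4 _≋_
  infixl 6 _+_ _-_
  infixl 7 _*_ _/_ _∙_
  infixr 8 _^_
  infix  8 -_
  infixl 9 _⟨_⟩

  _≋_ : Series → Series → Set ℓ
  p ≋ q = ∀ n → p n R.≈ q n

  const : R.Carrier → Series
  const r zero    = r
  const r (suc _) = R.0#

  1ₛ : Series
  1ₛ = const R.1#

  X : Series
  X 1 = R.1#
  X _ = R.0#

  _+_ _-_ _*_ : Series → Series → Series
  (p + q) n = p n R.+ q n
  (p - q) n = p n R.- q n
  (p * q) n = ∑[ i ≤ n ] (p (toℕ i) R.* q (n ∸ toℕ i))

  -_ : Series → Series
  (- p) n = R.- p n

  _∙_ : R.Carrier → Series → Series
  (r ∙ p) n = r R.* p n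

  _^_ : Series → ℕ → Series
  p ^ zero  = 1ₛ
  p ^ suc k = p * p ^ k

  -- p ⟨ q ⟩ is p(q(x)) for q with zero constant term: then [xⁿ] qʲ = 0 for
  -- j > n, so the sum over all j stops at n.
  _⟨_⟩ : Series → Series → Series
  (p ⟨ q ⟩) n = ∑[ j ≤ n ] (p (toℕ j) R.* (q ^ toℕ j) n)

  -- p / d is the quotient for d with constant term 1: the inverse of d is the
  -- geometric series in 1 - d.
  _/_ : Series → Series → Series
  p / d = p * ((λ _ → R.1#) ⟨ 1ₛ - d ⟩)

  -- The division by n + 1 is exact.
  catalan : ℕ → ℕ
  catalan n = ((2 ℕ.* n) C n) ℕ./ suc n

  Catalan : Series
  Catalan n = catalan n ×# R.1#

  record Array : Set c where
    constructor ⟪_,_⟫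
    field
      g f : Series

    entry : ℕ → ℕ → R.Carrier
    entry n k = (g * f ^ k) n

  open Array public using (entry)

  infix  4 _≃_
  infixl 7 _·_

  _≃_ : Array → Array → Set ℓ
  S ≃ T = ∀ n k → entry S n k R.≈ entry T n k

  _·_ : Array → Array → Array
  ⟪ g , f ⟫ · ⟪ u , v ⟫ = ⟪ g * u ⟨ f ⟩ , v ⟨ f ⟩ ⟫

  identity : Array
  identity = ⟪ 1ₛ , X ⟫

  bell : Series → Array
  bell g = ⟪ g , X * g ⟫

  -- The linear coefficient of xg(x) is g(0) = 1, so the requirement f₁ ≠ 0 on
  -- Riordan arrays is automatic here.
  record IsBellPseudoInvolution (g : Series) : Set ℓ where
    field
      g₀≈1       : g 0 R.≈ R.1#
      involution : ⟪ g , - (X * g) ⟫ · ⟪ g , - (X * g) ⟫ ≃ identity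

  record IsCompositionalInverse (f f̄ : Series) : Set ℓ where
    field
      f̄₀≈0    : f̄ 0 R.≈ R.0#
      inverseˡ : f̄ ⟨ f ⟩ ≋ X
      inverseʳ : f ⟨ f̄ ⟩ ≋ X

  -- x / f̄ is the series A with A f̄ = x; it is not an instance of _/_, since f̄
  -- has no constant term.
  IsASequence : Array → Series → Set (c ⊔ ℓ)
  IsASequence ⟪ g , f ⟫ A = ∃[ f̄ ] IsCompositionalInverse f f̄ × A * f̄ ≋ X

  -- Column k - 1, where column -1 is zero.
  entryLeft : Array → ℕ → ℕ → R.Carrier
  entryLeft T n zero    = R.0#
  entryLeft T n (suc k) = entry T n k

  -- Terms with j > n vanish, since there n - j < 0.
  IsBSequence : Array → Series → Set ℓ
  IsBSequence T b = ∀ n k → entry T (suc n) k R.≈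
    entryLeft T n k R.+ ∑[ j ≤ n ] (b (toℕ j) R.* entry T (n ∸ toℕ j) (k ℕ.+ toℕ j))

open FormalPowerSeries Complex.commutativeRing public

module Submission where

-- Column 0 of the B-sequence recurrence says g = 1 + x g B(x² g), which for the
-- given B becomes the quadratic equation e g + w g² = 1 with e = 1 - ax - bx²
-- and w = x²(b + cx).  Substituting f̄ for x, where A = g(f̄) and f̄ A = x, turns
-- it into a quadratic equation d v - v² = u for v = 1 + ax - A.  Since C = 1 + x C²,
-- the closed forms satisfy the same equations; and two solutions p, p′ of an
-- equation e p + w p² = s agree, because here e + w (p + p′) is always a unit.
--
-- The recurrence C = 1 + x C² for the binomial definition of the Catalan numbers
-- follows from (n + 2) C(n + 1) = 2 (2n + 1) C(n): it is a linear differential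
-- equation for C, from which 1 + x C² - C satisfies one with no nonzero solution
-- over ℤ.

open import Algebra.Bundles using (CommutativeRing)
import Algebra.Properties.Monoid.Sum
open import Data.Fin.Base using (Fin; toℕ) renaming (zero to fzero; suc to fsuc)
import Data.Fin.Properties as Finₚ
import Data.Integer.Base as ℤ
import Data.Integer.Properties as ℤₚ
open import Data.Nat.Base as ℕ using (ℕ; zero; suc; _∸_; s≤s; z≤n)
open import Data.Nat.Combinatorics
  using (_C_; nCk+nC[k+1]≡[n+1]C[k+1]; nC1≡n; k>n⇒nCk≡0; nCk≡nC[n∸k])
open import Data.Nat.Divisibility using (_∣_; ∣m+n∣m⇒∣n; m∣m*n)
import Data.Nat.DivMod as ℕ
import Data.Nat.Properties as ℕₚ
import Data.Nat.Solver as ℕ-Solver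
open import Data.Product.Base using (_,_)
open import Function.Base using (_∘_)
open import Relation.Binary.PropositionalEquality as ≡ using (_≡_)
open import Defs using (module FormalPowerSeries)
open FormalPowerSeries ℤₚ.+-*-commutativeRing using (catalan)

private
  module ℕ-Sum = Algebra.Properties.Monoid.Sum ℕₚ.+-0-monoid

-- Central binomial coefficients and the two-term Catalan recurrence.

module Binomials where
  open import Data.Nat.Base
  open ≡.≡-Reasoning
  open ℕ-Solver.+-*-Solver

  -- The rule (k + 1) C(n, k + 1) = (n - k) C(n, k), with the subtracted term moved to the left so
  -- that no truncated subtraction occurs. Two instances of Pascal's rule reduce row n + 1 to the
  -- cases k and k + 1 of row n.
  absorption : ∀ n k → suc k * (n C suc k) + k * (n C k) ≡ n * (n C k)
  absorption zero zero = ≡.refl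
  absorption zero (suc k)
    rewrite k>n⇒nCk≡0 {0} {suc k} (s≤s z≤n) | k>n⇒nCk≡0 {0} {suc (suc k)} (s≤s z≤n)
          | ℕₚ.*-zeroʳ k = ≡.refl
  absorption (suc n) zero rewrite nC1≡n (suc n) =
    solve 1 (λ n → (n :+ con 0) :+ con 0 := n :* con 1) ≡.refl (suc n)
  absorption (suc n) (suc k)
    rewrite ≡.sym (nCk+nC[k+1]≡[n+1]C[k+1] n k) | ≡.sym (nCk+nC[k+1]≡[n+1]C[k+1] n (suc k)) = begin
    suc (suc k) * (y + z) + suc k * (x + y)
      ≡⟨ solve 4 (λ k x y z →
           (con 2 :+ k) :* (y :+ z) :+ (con 1 :+ k) :* (x :+ y) :=
           ((con 2 :+ k) :* z :+ (con 1 :+ k) :* y) :+ ((con 1 :+ k) :* y :+ k :* x) :+ (x :+ y))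
           ≡.refl k x y z ⟩
    (suc (suc k) * z + suc k * y) + (suc k * y + k * x) + (x + y)
      ≡⟨ ≡.cong (_+ (x + y)) (≡.cong₂ _+_ (absorption n (suc k)) (absorption n k)) ⟩
    n * y + n * x + (x + y)
      ≡⟨ solve 3 (λ n x y → n :* y :+ n :* x :+ (x :+ y) := (con 1 :+ n) :* (x :+ y)) ≡.refl n x y ⟩
    suc n * (x + y) ∎
    where
    x = n C k
    y = n C suc k
    z = n C suc (suc k)

  -- `absorption` in row 2n at k = n has 2n B on the right, of which one n B cancels.
  central-neighbour : ∀ n → suc n * ((2 * n) C suc n) ≡ n * ((2 * n) C n)
  central-neighbour n = ℕₚ.+-cancelʳ-≡ (n * B) _ _ (begin
    suc n * ((2 * n) C suc n) + n * B ≡⟨ absorption (2 * n) n ⟩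
    2 * n * B                         ≡⟨ solve 2 (λ n b → con 2 :* n :* b := n :* b :+ n :* b) ≡.refl n B ⟩
    n * B + n * B                     ∎)
    where B = (2 * n) C n

  -- Exactness of the division in `catalan`: by `central-neighbour`, (n + 1) C(2n, n + 1) + B equals
  -- (n + 1) B, so n + 1 divides the sum and its first term, hence also B.
  suc[n]*catalan : ∀ n → suc n * catalan n ≡ (2 * n) C n
  suc[n]*catalan n = ℕ.m*[n/m]≡n suc[n]∣B
    where
    B = (2 * n) C n
    suc[n]∣B : suc n ∣ B
    suc[n]∣B = ∣m+n∣m⇒∣n
      (≡.subst (suc n ∣_)
        (≡.sym (≡.trans (≡.cong (_+ B) (central-neighbour n)) (ℕₚ.+-comm (n * B) B)))
        (m∣m*n B))
      (m∣m*n ((2 * n) C suc n))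

  -- Pascal's rule is applied twice. In between, symmetry of row 2n + 1 merges its two middle
  -- entries, and `central-neighbour` removes the remaining off-centre one.
  central-suc : ∀ n → suc n * ((2 * suc n) C suc n) ≡ 2 * (1 + 2 * n) * ((2 * n) C n)
  central-suc n = begin
    suc n * ((2 * suc n) C suc n)
      ≡⟨ ≡.cong (λ m → suc n * (m C suc n)) (solve 1 (λ n → con 2 :* (con 1 :+ n) := con 2 :+ con 2 :* n) ≡.refl n) ⟩
    suc n * (suc (suc (2 * n)) C suc n)
      ≡⟨ ≡.cong (suc n *_) (nCk+nC[k+1]≡[n+1]C[k+1] (suc (2 * n)) n) ⟨
    suc n * (suc (2 * n) C n + suc (2 * n) C suc n)
      ≡⟨ ≡.cong (λ m → suc n * (m + suc (2 * n) C suc n)) symmetric ⟩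
    suc n * (suc (2 * n) C suc n + suc (2 * n) C suc n)
      ≡⟨ ≡.cong (λ m → suc n * (m + m)) (nCk+nC[k+1]≡[n+1]C[k+1] (2 * n) n) ⟨
    suc n * ((B + B′) + (B + B′))
      ≡⟨ solve 3 (λ n b b′ → (con 1 :+ n) :* ((b :+ b′) :+ (b :+ b′)) :=
           con 2 :* ((con 1 :+ n) :* b :+ (con 1 :+ n) :* b′)) ≡.refl n B B′ ⟩
    2 * (suc n * B + suc n * B′)
      ≡⟨ ≡.cong (λ m → 2 * (suc n * B + m)) (central-neighbour n) ⟩
    2 * (suc n * B + n * B)
      ≡⟨ solve 2 (λ n b → con 2 :* ((con 1 :+ n) :* b :+ n :* b) := con 2 :* (con 1 :+ con 2 :* n) :* b) ≡.refl n B ⟩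
    2 * (1 + 2 * n) * B ∎
    where
    B  = (2 * n) C n
    B′ = (2 * n) C suc n
    1+2n≡n+[1+n] : suc (2 * n) ≡ n + suc n
    1+2n≡n+[1+n] = solve 1 (λ n → con 1 :+ con 2 :* n := n :+ (con 1 :+ n)) ≡.refl n
    symmetric : suc (2 * n) C n ≡ suc (2 * n) C suc n
    symmetric = ≡.trans
      (nCk≡nC[n∸k] (≡.subst (n ≤_) (≡.sym 1+2n≡n+[1+n]) (ℕₚ.m≤m+n n (suc n))))
      (≡.cong (suc (2 * n) C_) (≡.trans (≡.cong (_∸ n) 1+2n≡n+[1+n]) (ℕₚ.m+n∸m≡n n (suc n))))

  -- The factor n + 1 is inserted so that both sides become central binomial coefficients.
  catalan-suc : ∀ n → suc (suc n) * catalan (suc n) ≡ 2 * (1 + 2 * n) * catalan n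
  catalan-suc n = ℕₚ.*-cancelˡ-≡ _ _ (suc n) (begin
    suc n * (suc (suc n) * catalan (suc n))
      ≡⟨ ≡.cong (suc n *_) (suc[n]*catalan (suc n)) ⟩
    suc n * ((2 * suc n) C suc n)
      ≡⟨ central-suc n ⟩
    2 * (1 + 2 * n) * ((2 * n) C n)
      ≡⟨ ≡.cong (2 * (1 + 2 * n) *_) (suc[n]*catalan n) ⟨
    2 * (1 + 2 * n) * (suc n * catalan n)
      ≡⟨ solve 3 (λ m k c → m :* (k :* c) := k :* (m :* c)) ≡.refl (2 * (1 + 2 * n)) (suc n) (catalan n) ⟩
    suc n * (2 * (1 + 2 * n) * catalan n) ∎)

open Binomials using (catalan-suc)

-- Identities in a commutative ring, later used for power series.

module RingIdentities {c ℓ} (T : CommutativeRing c ℓ) where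

  open CommutativeRing T
  open import Algebra.Properties.Ring ring using (+-cancelʳ)
  open import Relation.Binary.Reasoning.Setoid setoid
  open import Algebra.Solver.Ring.NaturalCoefficients.Default commutativeSemiring
    using (Polynomial; solve; _:+_; _:*_; _:=_; con)

  -- The algebra behind multiplicativity of composition: the tail of a product is p₀ times the tail
  -- of the second factor plus the tail of the first times the whole second factor.
  horner-* : ∀ r p₀ q₀ p q →
             p₀ * q₀ + r * (p₀ * q + p * (q₀ + r * q)) ≈ (p₀ + r * p) * (q₀ + r * q)
  horner-* = solve 5 (λ r p₀ q₀ p q →
    p₀ :* q₀ :+ r :* (p₀ :* q :+ p :* (q₀ :+ r :* q)) := (p₀ :+ r :* p) :* (q₀ :+ r :* q)) refl

  geometric-inverse : ∀ d i → i ≈ 1# + (1# - d) * i → d * i ≈ 1#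
  geometric-inverse d i i≈1+[1-d]i = +-cancelʳ i (d * i) 1# (begin
    d * i + i                   ≈⟨ +-congˡ i≈1+[1-d]i ⟩
    d * i + (1# + (1# - d) * i) ≈⟨ solve 3 (λ d e i → d :* i :+ (con 1 :+ e :* i) := con 1 :+ (e :+ d) :* i)
                                     refl d (1# - d) i ⟩
    1# + ((1# - d) + d) * i     ≈⟨ +-congˡ (*-congʳ [1-d]+d≈1) ⟩
    1# + 1# * i                 ≈⟨ +-congˡ (*-identityˡ i) ⟩
    1# + i                      ∎)
    where
    [1-d]+d≈1 : (1# - d) + d ≈ 1#
    [1-d]+d≈1 = trans (+-assoc 1# (- d) d) (trans (+-congˡ (-‿inverseˡ d)) (+-identityʳ 1#))

  *-cancelʳ-invertible : ∀ p {d i} → d * i ≈ 1# → p * d ≈ 0# → p ≈ 0#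
  *-cancelʳ-invertible p {d} {i} di≈1 pd≈0 = begin
    p           ≈⟨ *-identityʳ p ⟨
    p * 1#      ≈⟨ *-congˡ di≈1 ⟨
    p * (d * i) ≈⟨ *-assoc p d i ⟨
    p * d * i   ≈⟨ *-congʳ pd≈0 ⟩
    0# * i      ≈⟨ zeroˡ i ⟩
    0#          ∎

  -- For p ↦ e p + w p² the difference of two values factors through p - q.
  quadratic-unique : ∀ e w p q {i} → (e + w * (p + q)) * i ≈ 1# →
                     e * p + w * (p * p) ≈ e * q + w * (q * q) → p ≈ q
  quadratic-unique e w p q inv h = begin
    p           ≈⟨ +-identityʳ p ⟨
    p + 0#      ≈⟨ +-congˡ (-‿inverseˡ q) ⟨
    p + (n + q) ≈⟨ +-assoc p n q ⟨
    (p + n) + q ≈⟨ +-congʳ (*-cancelʳ-invertible (p + n) inv factored) ⟩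
    0# + q      ≈⟨ +-identityˡ q ⟩
    q           ∎
    where
    -- The negation is treated as an atom; only its cancellation against q is used.
    n = - q
    factored : (p + n) * (e + w * (p + q)) ≈ 0#
    factored = begin
      (p + n) * (e + w * (p + q))
        ≈⟨ solve 5 (λ e w p q n → (p :+ n) :* (e :+ w :* (p :+ q)) :=
             (e :* p :+ w :* (p :* p)) :+ (e :* n :+ w :* (q :* n) :+ w :* p :* (q :+ n)))
             refl e w p q n ⟩
      (e * p + w * (p * p)) + (e * n + w * (q * n) + w * p * (q + n))
        ≈⟨ +-congʳ h ⟩
      (e * q + w * (q * q)) + (e * n + w * (q * n) + w * p * (q + n))
        ≈⟨ solve 5 (λ e w p q n →
             (e :* q :+ w :* (q :* q)) :+ (e :* n :+ w :* (q :* n) :+ w :* p :* (q :+ n)) :=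
             (q :+ n) :* (e :+ w :* q :+ w :* p)) refl e w p q n ⟩
      (q + n) * (e + w * q + w * p)
        ≈⟨ *-congʳ (-‿inverseʳ q) ⟩
      0# * (e + w * q + w * p)
        ≈⟨ zeroˡ _ ⟩
      0# ∎

  two four : Carrier → Carrier
  two x  = x + x
  four x = two (two x)

  -- With D the Catalan series, θ = x d/dx, t = θD, g = 1 + x D² and u = θg: the
  -- differential equation of D makes θ(g - D) + (g - D) = 4 x θ(g - D).
  catalan-residue : ∀ x d t {g u} →
    d + t ≈ 1# + x * (two d + four t) →
    g ≈ 1# + x * (d * d) → u ≈ x * (d * d) + x * (t * d + d * t) →
    (g + u) + x * four t ≈ (d + t) + x * four u
  catalan-residue x d t {g} {u} ode g≈ u≈ = begin
    (g + u) + x * four t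
      ≈⟨ +-congʳ (+-cong g≈ u≈) ⟩
    ((1# + x * (d * d)) + (x * (d * d) + x * (t * d + d * t))) + x * four t
      ≈⟨ solve 3 (λ x d t →
           ((con 1 :+ x :* (d :* d)) :+ (x :* (d :* d) :+ x :* (t :* d :+ d :* t))) :+ x :* :four t :=
           (con 1 :+ x :* :four t) :+ :two x :* d :* (d :+ t)) refl x d t ⟩
    (1# + x * four t) + two x * d * (d + t)
      ≈⟨ +-congˡ (*-congˡ ode) ⟩
    (1# + x * four t) + two x * d * (1# + x * (two d + four t))
      ≈⟨ solve 3 (λ x d t →
           (con 1 :+ x :* :four t) :+ :two x :* d :* (con 1 :+ x :* (:two d :+ :four t)) :=
           (con 1 :+ x :* (:two d :+ :four t)) :+ x :* :four (x :* (d :* d) :+ x :* (t :* d :+ d :* t)))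
           refl x d t ⟩
    (1# + x * (two d + four t)) + x * four (x * (d * d) + x * (t * d + d * t))
      ≈⟨ +-cong ode (*-congˡ (+-cong (+-cong u≈ u≈) (+-cong u≈ u≈))) ⟨
    (d + t) + x * four u ∎
    where
    :two : ∀ {n} → Polynomial n → Polynomial n
    :two p = p :+ p
    :four : ∀ {n} → Polynomial n → Polynomial n
    :four p = :two (:two p)
  -- The functional equation of g, written with f = x g so that substituting f̄
  -- for x only requires f(f̄) = x.
  bell-equation : ∀ a b c x g β →
    β * (1# + b * (x * (x * g))) + c * (x * (x * g)) ≈ a → g ≈ 1# + x * (g * β) →
    g + (b * ((x * g) * (x * g)) + c * (x * ((x * g) * (x * g)))) ≈
    1# + (b * (x * (x * g)) + a * (x * g))
  bell-equation a b c x g β β≈ g≈ = begin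
    g + (b * ((x * g) * (x * g)) + c * (x * ((x * g) * (x * g))))
      ≈⟨ solve 4 (λ b c x g → g :+ (b :* ((x :* g) :* (x :* g)) :+ c :* (x :* ((x :* g) :* (x :* g)))) :=
           g :* (con 1 :+ b :* (x :* (x :* g))) :+ x :* g :* (c :* (x :* (x :* g)))) refl b c x g ⟩
    g * (1# + b * z) + x * g * (c * z)
      ≈⟨ +-congʳ (*-congʳ g≈) ⟩
    (1# + x * (g * β)) * (1# + b * z) + x * g * (c * z)
      ≈⟨ solve 6 (λ b c x g β z → (con 1 :+ x :* (g :* β)) :* (con 1 :+ b :* z) :+ x :* g :* (c :* z) :=
           con 1 :+ (b :* z :+ (β :* (con 1 :+ b :* z) :+ c :* z) :* (x :* g))) refl b c x g β z ⟩
    1# + (b * z + (β * (1# + b * z) + c * z) * (x * g))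
      ≈⟨ +-congˡ (+-congˡ (*-congʳ β≈)) ⟩
    1# + (b * z + a * (x * g)) ∎
    where z = x * (x * g)

  -- The linear terms in g are gathered into `e`, which is described by what must be added to it to
  -- reach 1; adding those terms to both sides avoids subtraction.
  bell-quadratic : ∀ a b c x g e →
    g + (b * ((x * g) * (x * g)) + c * (x * ((x * g) * (x * g)))) ≈
      1# + (b * (x * (x * g)) + a * (x * g)) →
    e + (a * x + b * (x * x)) ≈ 1# →
    e * g + x * x * (b + c * x) * (g * g) ≈ 1#
  bell-quadratic a b c x g e eq e≈ = +-cancelʳ (b * (x * (x * g)) + a * (x * g)) _ _ (begin
    (e * g + x * x * (b + c * x) * (g * g)) + (b * (x * (x * g)) + a * (x * g))
      ≈⟨ solve 6 (λ a b c x g e →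
           (e :* g :+ x :* x :* (b :+ c :* x) :* (g :* g)) :+ (b :* (x :* (x :* g)) :+ a :* (x :* g)) :=
           (e :+ (a :* x :+ b :* (x :* x))) :* g :+
             (b :* ((x :* g) :* (x :* g)) :+ c :* (x :* ((x :* g) :* (x :* g))))) refl a b c x g e ⟩
    (e + (a * x + b * (x * x))) * g + (b * ((x * g) * (x * g)) + c * (x * ((x * g) * (x * g))))
      ≈⟨ +-congʳ (trans (*-congʳ e≈) (*-identityˡ g)) ⟩
    g + (b * ((x * g) * (x * g)) + c * (x * ((x * g) * (x * g))))
      ≈⟨ eq ⟩
    1# + (b * (x * (x * g)) + a * (x * g)) ∎)

  -- Multiplying the first hypothesis by `A` eliminates `f̄`, since each term contains it at most
  -- once and `f̄ * A` is x. The relation for `v + A` then eliminates `A`.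
  A-quadratic : ∀ a b c x f̄ A v →
    A + (b * (x * x) + c * (f̄ * (x * x))) ≈ 1# + (b * (f̄ * x) + a * x) →
    f̄ * A ≈ x → v + A ≈ 1# + a * x →
    (1# + a * x + b * (x * x)) * v + - 1# * (v * v) ≈ (a * b + c) * (x * (x * x))
  A-quadratic a b c x f̄ A v eq f̄A≈x v+A≈ = begin
    d * v + n * (v * v)
      ≈⟨ +-congʳ dv≈ ⟩
    (v * v + u) + n * (v * v)
      ≈⟨ solve 3 (λ v u n → (v :* v :+ u) :+ n :* (v :* v) := u :+ (con 1 :+ n) :* (v :* v)) refl v u n ⟩
    u + (1# + n) * (v * v)
      ≈⟨ +-congˡ (trans (*-congʳ (-‿inverseʳ 1#)) (zeroˡ (v * v))) ⟩
    u + 0#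
      ≈⟨ +-identityʳ u ⟩
    u ∎
    where
    n = - 1#
    d = 1# + a * x + b * (x * x)
    u = (a * b + c) * (x * (x * x))
    A-quadratic′ : A * A + (b * (x * x) * A + c * (x * (x * x))) ≈ (v + A) * A + b * (x * x)
    A-quadratic′ = begin
      A * A + (b * (x * x) * A + c * (x * (x * x)))
        ≈⟨ +-congˡ (+-congˡ (*-congˡ (*-congʳ f̄A≈x))) ⟨
      A * A + (b * (x * x) * A + c * (f̄ * A * (x * x)))
        ≈⟨ solve 5 (λ A b c x f̄ → A :* A :+ (b :* (x :* x) :* A :+ c :* (f̄ :* A :* (x :* x))) :=
             (A :+ (b :* (x :* x) :+ c :* (f̄ :* (x :* x)))) :* A) refl A b c x f̄ ⟩
      (A + (b * (x * x) + c * (f̄ * (x * x)))) * A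
        ≈⟨ *-congʳ eq ⟩
      (1# + (b * (f̄ * x) + a * x)) * A
        ≈⟨ solve 5 (λ A a b x f̄ → (con 1 :+ (b :* (f̄ :* x) :+ a :* x)) :* A :=
             (con 1 :+ a :* x) :* A :+ b :* (f̄ :* A :* x)) refl A a b x f̄ ⟩
      (1# + a * x) * A + b * (f̄ * A * x)
        ≈⟨ +-cong (*-congʳ v+A≈) (*-congˡ (*-congʳ (sym f̄A≈x))) ⟨
      (v + A) * A + b * (x * x) ∎
    dv≈ : d * v ≈ v * v + u
    -- With A² + bx² added, the left side contains (v + A) A + bx², to which `A-quadratic′` applies;
    -- the same terms come back at the end and cancel.
    dv≈ = +-cancelʳ (A * A + b * (x * x)) _ _ (begin
      d * v + (A * A + b * (x * x))
        ≈⟨ +-congʳ (*-congʳ (+-congʳ v+A≈)) ⟨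
      (v + A + b * (x * x)) * v + (A * A + b * (x * x))
        ≈⟨ solve 4 (λ v A b x → (v :+ A :+ b :* (x :* x)) :* v :+ (A :* A :+ b :* (x :* x)) :=
             ((v :+ A) :* A :+ b :* (x :* x)) :+ (v :* v :+ b :* (x :* x) :* v)) refl v A b x ⟩
      ((v + A) * A + b * (x * x)) + (v * v + b * (x * x) * v)
        ≈⟨ +-congʳ A-quadratic′ ⟨
      (A * A + (b * (x * x) * A + c * (x * (x * x)))) + (v * v + b * (x * x) * v)
        ≈⟨ solve 5 (λ v A b c x →
             (A :* A :+ (b :* (x :* x) :* A :+ c :* (x :* (x :* x)))) :+ (v :* v :+ b :* (x :* x) :* v) :=
             b :* (x :* x) :* (v :+ A) :+ (A :* A :+ c :* (x :* (x :* x)) :+ v :* v)) refl v A b c x ⟩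
      b * (x * x) * (v + A) + (A * A + c * (x * (x * x)) + v * v)
        ≈⟨ +-congʳ (*-congˡ v+A≈) ⟩
      b * (x * x) * (1# + a * x) + (A * A + c * (x * (x * x)) + v * v)
        ≈⟨ solve 6 (λ v A a b c x →
             b :* (x :* x) :* (con 1 :+ a :* x) :+ (A :* A :+ c :* (x :* (x :* x)) :+ v :* v) :=
             (v :* v :+ (a :* b :+ c) :* (x :* (x :* x))) :+ (A :* A :+ b :* (x :* x))) refl v A a b c x ⟩
      (v * v + u) + (A * A + b * (x * x)) ∎)

  -- Here `j` is 1/e, and y = -ws/e². Scaling a solution of k = 1 + y k² by s/e solves e p + w p² =
  -- s. The case s = 1 serves `g`, the case w = -1 serves the A-sequence.
  catalan-root : ∀ e w s {j y k} → e * j ≈ 1# → y * (e * e) + w * s ≈ 0# → k ≈ 1# + y * (k * k) →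
                 e * (s * j * k) + w * ((s * j * k) * (s * j * k)) ≈ s
  catalan-root e w s {j} {y} {k} ej≈1 ye²+ws≈0 k≈ = begin
    e * (s * j * k) + w * ((s * j * k) * (s * j * k))
      ≈⟨ solve 5 (λ e w s j k → e :* (s :* j :* k) :+ w :* ((s :* j :* k) :* (s :* j :* k)) :=
           s :* (e :* j) :* k :+ r w s j k) refl e w s j k ⟩
    s * (e * j) * k + w * s * (s * j * j * (k * k))
      ≈⟨ +-congʳ (trans (*-congʳ (trans (*-congˡ ej≈1) (*-identityʳ s))) (*-congˡ k≈)) ⟩
    s * (1# + y * (k * k)) + w * s * (s * j * j * (k * k))
      -- The factor (e j)² = 1 is inserted so that y e² appears and cancels against w s.
      ≈⟨ +-congʳ (*-congˡ (+-congˡ (*-congʳ y≈))) ⟩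
    s * (1# + y * ((e * j) * (e * j)) * (k * k)) + w * s * (s * j * j * (k * k))
      ≈⟨ solve 6 (λ e w s j y k →
           s :* (con 1 :+ y :* ((e :* j) :* (e :* j)) :* (k :* k)) :+ r w s j k :=
           s :+ (y :* (e :* e) :+ w :* s) :* (s :* j :* j :* (k :* k))) refl e w s j y k ⟩
    s + (y * (e * e) + w * s) * (s * j * j * (k * k))
      ≈⟨ +-congˡ (trans (*-congʳ ye²+ws≈0) (zeroˡ _)) ⟩
    s + 0#
      ≈⟨ +-identityʳ s ⟩
    s ∎
    where
    r : ∀ {n} (w s j k : Polynomial n) → Polynomial n
    r w s j k = w :* s :* (s :* j :* j :* (k :* k))
    y≈ : y ≈ y * ((e * j) * (e * j))
    y≈ = sym (trans (*-congˡ (trans (*-cong ej≈1 ej≈1) (*-identityˡ 1#))) (*-identityʳ y))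

-- The ring of formal power series.

module PowerSeries {c ℓ} (R : CommutativeRing c ℓ) where

  private module R = CommutativeRing R
  open FormalPowerSeries R hiding (catalan)
  open import Algebra.Properties.Monoid.Sum R.+-monoid
  open import Algebra.Properties.CommutativeMonoid.Sum R.+-commutativeMonoid using (∑-distrib-+)
  open import Algebra.Properties.Semiring.Sum R.semiring using (*-distribˡ-sum)
  open import Relation.Binary.Reasoning.Setoid R.setoid
  open import Algebra.Solver.Ring.NaturalCoefficients.Default R.commutativeSemiring
    using (solve; _:+_; _:*_; _:=_; con)

  0ₛ : Series
  0ₛ _ = R.0#

  -- (p * q) (suc n) unfolds to p 0 R.* q (suc n) R.+ (tail p * q) n, so identities
  -- between products follow by induction on the index of the coefficient.
  tail : Series → Series
  tail p n = p (suc n)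

  *-cong : ∀ {p p′ q q′} → p ≋ p′ → q ≋ q′ → p * q ≋ p′ * q′
  *-cong h k n = sum-cong-≋ {n = suc n} λ i → R.*-cong (h (toℕ i)) (k (n ∸ toℕ i))

  *-distribʳ-+ : ∀ s p q → (p + q) * s ≋ p * s + q * s
  *-distribʳ-+ s p q zero =
    solve 3 (λ s p q → (p :+ q) :* s :+ con 0 := (p :* s :+ con 0) :+ (q :* s :+ con 0))
      R.refl (s 0) (p 0) (q 0)
  *-distribʳ-+ s p q (suc n) = begin
    (p 0 R.+ q 0) R.* s (suc n) R.+ ((tail p + tail q) * s) n
      ≈⟨ R.+-congˡ (*-distribʳ-+ s (tail p) (tail q) n) ⟩
    (p 0 R.+ q 0) R.* s (suc n) R.+ ((tail p * s) n R.+ (tail q * s) n)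
      ≈⟨ solve 5 (λ s p q x y → (p :+ q) :* s :+ (x :+ y) := (p :* s :+ x) :+ (q :* s :+ y))
           R.refl (s (suc n)) (p 0) (q 0) _ _ ⟩
    (p 0 R.* s (suc n) R.+ (tail p * s) n) R.+ (q 0 R.* s (suc n) R.+ (tail q * s) n) ∎

  ∙-*-assoc : ∀ r p q → (r ∙ p) * q ≋ r ∙ (p * q)
  ∙-*-assoc r p q zero =
    solve 3 (λ r p q → r :* p :* q :+ con 0 := r :* (p :* q :+ con 0)) R.refl r (p 0) (q 0)
  ∙-*-assoc r p q (suc n) = begin
    r R.* p 0 R.* q (suc n) R.+ ((r ∙ tail p) * q) n
      ≈⟨ R.+-congˡ (∙-*-assoc r (tail p) q n) ⟩
    r R.* p 0 R.* q (suc n) R.+ r R.* (tail p * q) n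
      ≈⟨ solve 4 (λ r p q x → r :* p :* q :+ r :* x := r :* (p :* q :+ x))
           R.refl r (p 0) (q (suc n)) _ ⟩
    r R.* (p 0 R.* q (suc n) R.+ (tail p * q) n) ∎

  *-assoc : ∀ p q s → (p * q) * s ≋ p * (q * s)
  *-assoc p q s zero =
    solve 3 (λ p q s → (p :* q :+ con 0) :* s :+ con 0 := p :* (q :* s :+ con 0) :+ con 0)
      R.refl (p 0) (q 0) (s 0)
  *-assoc p q s (suc n) = begin
    (p * q) 0 R.* s (suc n) R.+ ((p 0 ∙ tail q + tail p * q) * s) n
      ≈⟨ R.+-congˡ (*-distribʳ-+ s (p 0 ∙ tail q) (tail p * q) n) ⟩
    (p * q) 0 R.* s (suc n) R.+ (((p 0 ∙ tail q) * s) n R.+ ((tail p * q) * s) n)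
      ≈⟨ R.+-congˡ (R.+-cong (∙-*-assoc (p 0) (tail q) s n) (*-assoc (tail p) q s n)) ⟩
    (p * q) 0 R.* s (suc n) R.+ (p 0 R.* (tail q * s) n R.+ (tail p * (q * s)) n)
      ≈⟨ solve 5 (λ p q s x y → (p :* q :+ con 0) :* s :+ (p :* x :+ y) := p :* (q :* s :+ x) :+ y)
           R.refl (p 0) (q 0) (s (suc n)) _ _ ⟩
    p 0 R.* (q 0 R.* s (suc n) R.+ (tail q * s) n) R.+ (tail p * (q * s)) n ∎

  -- The mirror image of the defining recursion, peeling the right factor instead of the left;
  -- commutativity then follows by induction.
  *-tailʳ : ∀ p q n → (p * q) (suc n) R.≈ p (suc n) R.* q 0 R.+ (p * tail q) n
  *-tailʳ p q zero =
    solve 4 (λ p₀ p₁ q₀ q₁ → p₀ :* q₁ :+ (p₁ :* q₀ :+ con 0) := p₁ :* q₀ :+ (p₀ :* q₁ :+ con 0))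
      R.refl (p 0) (p 1) (q 0) (q 1)
  *-tailʳ p q (suc n) = begin
    p 0 R.* q (suc (suc n)) R.+ (tail p * q) (suc n)
      ≈⟨ R.+-congˡ (*-tailʳ (tail p) q n) ⟩
    p 0 R.* q (suc (suc n)) R.+ (p (suc (suc n)) R.* q 0 R.+ (tail p * tail q) n)
      ≈⟨ solve 3 (λ x y z → x :+ (y :+ z) := y :+ (x :+ z)) R.refl _ _ _ ⟩
    p (suc (suc n)) R.* q 0 R.+ (p 0 R.* q (suc (suc n)) R.+ (tail p * tail q) n) ∎

  *-comm : ∀ p q → p * q ≋ q * p
  *-comm p q zero = R.+-congʳ (R.*-comm (p 0) (q 0))
  *-comm p q (suc n) = begin
    p 0 R.* q (suc n) R.+ (tail p * q) n   ≈⟨ R.+-cong (R.*-comm _ _) (*-comm (tail p) q n) ⟩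
    q (suc n) R.* p 0 R.+ (q * tail p) n   ≈⟨ *-tailʳ q p n ⟨
    (q * p) (suc n)                        ∎

  *-zeroˡ : ∀ p → 0ₛ * p ≋ 0ₛ
  *-zeroˡ p zero    = R.trans (R.+-identityʳ _) (R.zeroˡ _)
  *-zeroˡ p (suc n) = R.trans (R.+-cong (R.zeroˡ _) (*-zeroˡ p n)) (R.+-identityˡ _)

  const-* : ∀ r p → const r * p ≋ r ∙ p
  const-* r p zero    = R.+-identityʳ _
  const-* r p (suc n) = R.trans (R.+-congˡ (*-zeroˡ p n)) (R.+-identityʳ _)

  commutativeRing : CommutativeRing c ℓ
  commutativeRing = record
    { Carrier = Series ; _≈_ = _≋_ ; _+_ = _+_ ; _*_ = _*_ ; -_ = -_ ; 0# = 0ₛ ; 1# = 1ₛ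
    ; isCommutativeRing = record
      { isRing = record
        { +-isAbelianGroup = record
          { isGroup = record
            { isMonoid = record
              { isSemigroup = record
                { isMagma = record
                  { isEquivalence = record
                    { refl  = λ _ → R.refl
                    ; sym   = λ h n → R.sym (h n)
                    ; trans = λ h k n → R.trans (h n) (k n)
                    }
                  ; ∙-cong = λ h k n → R.+-cong (h n) (k n)
                  }
                ; assoc = λ p q s n → R.+-assoc (p n) (q n) (s n)
                }
              ; identity = (λ p n → R.+-identityˡ (p n)) , (λ p n → R.+-identityʳ (p n))
              }
            ; inverse = (λ p n → R.-‿inverseˡ (p n)) , (λ p n → R.-‿inverseʳ (p n))
            ; ⁻¹-cong = λ h n → R.-‿cong (h n)
            }
          ; comm = λ p q n → R.+-comm (p n) (q n)
          }
        ; *-cong = *-cong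
        ; *-assoc = *-assoc
        ; *-identity = identityˡ , (λ p n → R.trans (*-comm p 1ₛ n) (identityˡ p n))
        ; distrib = distribˡ , *-distribʳ-+
        }
      ; *-comm = *-comm
      }
    }
    where
    identityˡ : ∀ p → 1ₛ * p ≋ p
    identityˡ p n = R.trans (const-* R.1# p n) (R.*-identityˡ (p n))
    distribˡ : ∀ s p q → s * (p + q) ≋ s * p + s * q
    distribˡ s p q n = begin
      (s * (p + q)) n           ≈⟨ *-comm s (p + q) n ⟩
      ((p + q) * s) n           ≈⟨ *-distribʳ-+ s p q n ⟩
      (p * s) n R.+ (q * s) n   ≈⟨ R.+-cong (*-comm p s n) (*-comm q s n) ⟩
      (s * p) n R.+ (s * q) n   ∎

  private module S = CommutativeRing commutativeRing
  open RingIdentities commutativeRing using (horner-*; geometric-inverse)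

  const-*-const : ∀ r s → const (r R.* s) ≋ const r * const s
  const-*-const r s zero    = R.sym (R.+-identityʳ _)
  const-*-const r s (suc n) = R.sym (R.trans (const-* r (const s) (suc n)) (R.zeroʳ r))

  const-+-const : ∀ r s → const (r R.+ s) ≋ const r + const s
  const-+-const r s zero    = R.refl
  const-+-const r s (suc n) = R.sym (R.+-identityˡ _)

  tail-X : tail X ≋ 1ₛ
  tail-X zero    = R.refl
  tail-X (suc n) = R.refl

  X-*-suc : ∀ p n → (X * p) (suc n) R.≈ p n
  X-*-suc p n = begin
    R.0# R.* p (suc n) R.+ (tail X * p) n
      ≈⟨ R.+-cong (R.zeroˡ _) (*-cong {tail X} {1ₛ} {p} tail-X (S.refl {p}) n) ⟩
    R.0# R.+ (1ₛ * p) n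
      ≈⟨ R.trans (R.+-identityˡ _) (S.*-identityˡ p n) ⟩
    p n ∎

  X-*-zero : ∀ p → (X * p) 0 R.≈ R.0#
  X-*-zero p = R.trans (R.+-identityʳ _) (R.zeroˡ _)

  X-*-cancel : ∀ p q → X * p ≋ X * q → p ≋ q
  X-*-cancel p q h n = begin
    p n             ≈⟨ X-*-suc p n ⟨
    (X * p) (suc n) ≈⟨ h (suc n) ⟩
    (X * q) (suc n) ≈⟨ X-*-suc q n ⟩
    q n             ∎

  X^-* : ∀ {j n} p → j ℕ.≤ n → (X ^ j * p) n R.≈ p (n ∸ j)
  X^-* {zero}  {n} p z≤n = S.*-identityˡ p n
  X^-* {suc j} {suc n} p (s≤s j≤n) = begin
    (X * X ^ j * p) (suc n)   ≈⟨ S.*-assoc X (X ^ j) p (suc n) ⟩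
    (X * (X ^ j * p)) (suc n) ≈⟨ X-*-suc (X ^ j * p) n ⟩
    (X ^ j * p) n             ≈⟨ X^-* p j≤n ⟩
    p (n ∸ j)                 ∎

  *-^ : ∀ p q k → (p * q) ^ k ≋ p ^ k * q ^ k
  *-^ p q zero    = S.sym (S.*-identityˡ 1ₛ)
  *-^ p q (suc k) = S.trans (S.*-congˡ {p * q} (*-^ p q k)) (interchange p q (p ^ k) (q ^ k))
    where open import Algebra.Properties.CommutativeSemigroup S.*-commutativeSemigroup using (interchange)

  *-cong-≤ : ∀ n {p q} r → (∀ m → m ℕ.≤ n → p m R.≈ q m) → (r * p) n R.≈ (r * q) n
  *-cong-≤ n r h = sum-cong-≋ {n = suc n} λ i → R.*-congˡ {r (toℕ i)} (h (n ∸ toℕ i) (ℕₚ.m∸n≤m n (toℕ i)))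

  *-distribˡ-∑ : ∀ p m (f : Fin m → R.Carrier) (s : Fin m → Series) →
                 p * (λ n → ∑[ i < m ] (f i R.* s i n)) ≋ (λ n → ∑[ i < m ] (f i R.* (p * s i) n))
  *-distribˡ-∑ p zero    f s n = S.zeroʳ p n
  *-distribˡ-∑ p (suc m) f s n = begin
    (p * ((f fzero ∙ s fzero) + rest)) n
      ≈⟨ S.distribˡ p (f fzero ∙ s fzero) rest n ⟩
    (p * (f fzero ∙ s fzero)) n R.+ (p * rest) n
      ≈⟨ R.+-cong head≈ (*-distribˡ-∑ p m (f ∘ fsuc) (s ∘ fsuc) n) ⟩
    f fzero R.* (p * s fzero) n R.+ ∑[ i < m ] (f (fsuc i) R.* (p * s (fsuc i)) n) ∎
    where
    rest : Series
    rest n = ∑[ i < m ] (f (fsuc i) R.* s (fsuc i) n)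
    head≈ : (p * (f fzero ∙ s fzero)) n R.≈ f fzero R.* (p * s fzero) n
    head≈ = begin
      (p * (f fzero ∙ s fzero)) n ≈⟨ *-comm p (f fzero ∙ s fzero) n ⟩
      ((f fzero ∙ s fzero) * p) n ≈⟨ ∙-*-assoc (f fzero) (s fzero) p n ⟩
      f fzero R.* (s fzero * p) n ≈⟨ R.*-congˡ (*-comm (s fzero) p n) ⟩
      f fzero R.* (p * s fzero) n ∎

  ⟨⟩-cong : ∀ r {p q} → p ≋ q → p ⟨ r ⟩ ≋ q ⟨ r ⟩
  ⟨⟩-cong r h n = sum-cong-≋ {n = suc n} λ j → R.*-congʳ {(r ^ toℕ j) n} (h (toℕ j))

  ⟨⟩-+ : ∀ r p q → (p + q) ⟨ r ⟩ ≋ p ⟨ r ⟩ + q ⟨ r ⟩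
  ⟨⟩-+ r p q n = R.trans
    (sum-cong-≋ {n = suc n} λ j → R.distribʳ ((r ^ toℕ j) n) (p (toℕ j)) (q (toℕ j)))
    (∑-distrib-+ {suc n} (λ j → p (toℕ j) R.* (r ^ toℕ j) n) (λ j → q (toℕ j) R.* (r ^ toℕ j) n))

  ⟨⟩-∙ : ∀ r a p → (a ∙ p) ⟨ r ⟩ ≋ a ∙ p ⟨ r ⟩
  ⟨⟩-∙ r a p n = R.trans
    (sum-cong-≋ {n = suc n} λ j → R.*-assoc a (p (toℕ j)) ((r ^ toℕ j) n))
    (R.sym (*-distribˡ-sum {suc n} a (λ j → p (toℕ j) R.* (r ^ toℕ j) n)))

  0ₛ⟨⟩ : ∀ r → 0ₛ ⟨ r ⟩ ≋ 0ₛ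
  0ₛ⟨⟩ r n = begin
    (0ₛ ⟨ r ⟩) n          ≈⟨ ⟨⟩-cong r {0ₛ} {R.0# ∙ 0ₛ} (λ _ → R.sym (R.zeroˡ _)) n ⟩
    ((R.0# ∙ 0ₛ) ⟨ r ⟩) n ≈⟨ ⟨⟩-∙ r R.0# 0ₛ n ⟩
    R.0# R.* (0ₛ ⟨ r ⟩) n ≈⟨ R.zeroˡ _ ⟩
    R.0#                  ∎

  -- Composition with a series without constant term.

  module Composition (r : Series) (r₀≈0 : r 0 R.≈ R.0#) where

    -- The only summand of coefficient n that reaches `p n` carries the factor `r 0`, which is zero.
    -- This drop in index drives the inductions below.
    *-cong-< : ∀ n {p q} → (∀ m → m ℕ.< n → p m R.≈ q m) → (r * p) n R.≈ (r * q) n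
    *-cong-< zero    {p} {q} h = R.+-congʳ (R.trans (r₀*≈0 (p 0)) (R.sym (r₀*≈0 (q 0))))
      where
      r₀*≈0 : ∀ x → r 0 R.* x R.≈ R.0#
      r₀*≈0 x = R.trans (R.*-congʳ r₀≈0) (R.zeroˡ x)
    *-cong-< (suc n) {p} {q} h = R.+-cong
      (R.trans (R.*-congʳ r₀≈0) (R.trans (R.zeroˡ _) (R.sym (R.trans (R.*-congʳ r₀≈0) (R.zeroˡ _)))))
      (*-cong-≤ n {p} {q} (tail r) λ m m≤n → h m (s≤s m≤n))

    -- In `p ⟨ r ⟩` the number of summands varies with the coefficient. A fixed bound gives a
    -- genuine linear combination of powers of r, over which products distribute; the composite is
    -- its diagonal, with bound n at coefficient n.
    truncated : ℕ → Series → Series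
    truncated N p n = ∑[ j ≤ N ] (p (toℕ j) R.* (r ^ toℕ j) n)

    private
      ∙1≋const : ∀ a → a ∙ 1ₛ ≋ const a
      ∙1≋const a = S.trans (S.sym (const-* a 1ₛ)) (S.*-identityʳ (const a))

    truncated-suc : ∀ N p → truncated (suc N) p ≋ const (p 0) + r * truncated N (tail p)
    truncated-suc N p n = R.+-cong (∙1≋const (p 0) n)
      (R.sym (*-distribˡ-∑ r (suc N) (λ j → tail p (toℕ j)) (λ j → r ^ toℕ j) n))

    *-vanish : ∀ p → (r * p) 0 R.≈ R.0#
    *-vanish p = R.trans (*-cong-< 0 {p} {0ₛ} λ _ ()) (S.zeroʳ r 0)

    truncated-0 : ∀ N p → truncated N p 0 R.≈ p 0
    truncated-0 zero    p = R.trans (R.+-identityʳ _) (R.*-identityʳ _)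
    truncated-0 (suc N) p = R.trans (truncated-suc N p 0)
      (R.trans (R.+-congˡ (*-vanish (truncated N (tail p)))) (R.+-identityʳ _))

    -- Since r has no constant term, powers beyond the n-th do not reach coefficient n. One factor r
    -- is split off, which lowers the bounds and the index together.
    truncated-stable : ∀ M N {n} p → n ℕ.≤ M → n ℕ.≤ N → truncated M p n R.≈ truncated N p n
    truncated-stable M N {zero} p _ _ = R.trans (truncated-0 M p) (R.sym (truncated-0 N p))
    truncated-stable (suc M) (suc N) {suc n} p (s≤s n≤M) (s≤s n≤N) = begin
      truncated (suc M) p (suc n)
        ≈⟨ truncated-suc M p (suc n) ⟩
      R.0# R.+ (r * truncated M (tail p)) (suc n)
        ≈⟨ R.+-congˡ (*-cong-< (suc n) {truncated M (tail p)} {truncated N (tail p)}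
             λ { m (s≤s m≤n) → truncated-stable M N (tail p) (ℕₚ.≤-trans m≤n n≤M) (ℕₚ.≤-trans m≤n n≤N) }) ⟩
      R.0# R.+ (r * truncated N (tail p)) (suc n)
        ≈⟨ truncated-suc N p (suc n) ⟨
      truncated (suc N) p (suc n) ∎

    -- A recursion replacing the diagonal sum; multiplicativity of composition and the geometric
    -- inverse both rest on it.
    horner : ∀ p → p ⟨ r ⟩ ≋ const (p 0) + r * tail p ⟨ r ⟩
    horner p zero    = R.trans (truncated-0 0 p)
      (R.sym (R.trans (R.+-congˡ (*-vanish (tail p ⟨ r ⟩))) (R.+-identityʳ _)))
    horner p (suc n) = R.trans (truncated-suc n p (suc n))
      (R.+-congˡ (*-cong-< (suc n) {truncated n (tail p)} {tail p ⟨ r ⟩}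
        -- The truncation has bound n for all its coefficients, the composite has bound m at
        -- coefficient m.
        λ { m (s≤s m≤n) → truncated-stable n m (tail p) m≤n ℕₚ.≤-refl }))

    ⟨⟩-const : ∀ a → const a ⟨ r ⟩ ≋ const a
    ⟨⟩-const a = S.trans (horner (const a))
      (S.trans (S.+-congˡ {const a} (S.trans (S.*-congˡ {r} (0ₛ⟨⟩ r)) (S.zeroʳ r)))
        (S.+-identityʳ (const a)))

    ⟨⟩-* : ∀ p q → (p * q) ⟨ r ⟩ ≋ p ⟨ r ⟩ * q ⟨ r ⟩
    ⟨⟩-* p q n = below (suc n) p q n ℕₚ.≤-refl
      where
      -- Strong induction on the coefficient, bounded by `N`. The series stay general because the
      -- recursive call replaces p by its tail.
      below : ∀ N p q n → n ℕ.< N → ((p * q) ⟨ r ⟩) n R.≈ (p ⟨ r ⟩ * q ⟨ r ⟩) n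
      below (suc N) p q n (s≤s n≤N) = begin
        ((p * q) ⟨ r ⟩) n
          ≈⟨ horner (p * q) n ⟩
        const ((p * q) 0) n R.+ (r * tail (p * q) ⟨ r ⟩) n
          ≈⟨ R.+-cong (const-cong (R.+-identityʳ _) n)
               (*-cong-< n {tail (p * q) ⟨ r ⟩} {const p₀ * q′ + p′ * q ⟨ r ⟩} tail-below) ⟩
        const (p₀ R.* q₀) n R.+ (r * (const p₀ * q′ + p′ * q ⟨ r ⟩)) n
          ≈⟨ S.+-congʳ {r * (const p₀ * q′ + p′ * q ⟨ r ⟩)} (const-*-const p₀ q₀) n ⟩
        (const p₀ * const q₀ + r * (const p₀ * q′ + p′ * q ⟨ r ⟩)) n
          ≈⟨ S.+-congˡ {const p₀ * const q₀}
               (S.*-congˡ {r} (S.+-congˡ {const p₀ * q′} (S.*-congˡ {p′} (horner q)))) n ⟩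
        (const p₀ * const q₀ + r * (const p₀ * q′ + p′ * (const q₀ + r * q′))) n
          ≈⟨ horner-* r (const p₀) (const q₀) p′ q′ n ⟩
        ((const p₀ + r * p′) * (const q₀ + r * q′)) n
          ≈⟨ *-cong (horner p) (horner q) n ⟨
        (p ⟨ r ⟩ * q ⟨ r ⟩) n ∎
        where
        p₀ = p 0
        q₀ = q 0
        p′ q′ : Series
        p′ = tail p ⟨ r ⟩
        q′ = tail q ⟨ r ⟩
        const-cong : ∀ {a b} → a R.≈ b → const a ≋ const b
        const-cong h zero    = h
        const-cong h (suc _) = R.refl
        tail-below : ∀ m → m ℕ.< n → (tail (p * q) ⟨ r ⟩) m R.≈ (const p₀ * q′ + p′ * q ⟨ r ⟩) m
        tail-below m m<n = begin
          ((p₀ ∙ tail q + tail p * q) ⟨ r ⟩) m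
            ≈⟨ ⟨⟩-+ r (p₀ ∙ tail q) (tail p * q) m ⟩
          ((p₀ ∙ tail q) ⟨ r ⟩) m R.+ ((tail p * q) ⟨ r ⟩) m
            ≈⟨ R.+-cong (⟨⟩-∙ r p₀ (tail q) m) (below N (tail p) q m (ℕₚ.<-≤-trans m<n n≤N)) ⟩
          (p₀ ∙ q′) m R.+ (p′ * q ⟨ r ⟩) m
            ≈⟨ R.+-congʳ (const-* p₀ q′ m) ⟨
          (const p₀ * q′) m R.+ (p′ * q ⟨ r ⟩) m ∎

    ⟨⟩-X : X ⟨ r ⟩ ≋ r
    ⟨⟩-X = S.trans (horner X)
      (S.trans (S.+-cong {const R.0#} {0ₛ} const-0
        (S.trans (S.*-congˡ {r} (S.trans (⟨⟩-cong r tail-X) (⟨⟩-const R.1#))) (S.*-identityʳ r)))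
        (S.+-identityˡ r))
      where
      const-0 : const R.0# ≋ 0ₛ
      const-0 zero    = R.refl
      const-0 (suc _) = R.refl

  -- The geometric factor of `_/_`, so that `p / d` is `p * 1/ d` by definition.
  1/ : Series → Series
  1/ d = (λ _ → R.1#) ⟨ 1ₛ - d ⟩

  -- The all-ones series is its own tail, so `horner` reads i = 1 + (1 - d) i.
  *-inverseʳ : ∀ d → d 0 R.≈ R.1# → d * 1/ d ≋ 1ₛ
  *-inverseʳ d d₀≈1 = geometric-inverse d (1/ d) (horner (λ _ → R.1#))
    where
    open Composition (1ₛ - d) (R.trans (R.+-congˡ (R.-‿cong d₀≈1)) (R.-‿inverseʳ R.1#)) using (horner)

-- The quadratic equation of the Catalan series.

segner : ℕ → ℕ
segner n = ℕ-Sum.sum {suc n} λ i → catalan (toℕ i) ℕ.* catalan (n ∸ toℕ i)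

module CatalanSeries {c ℓ} (R : CommutativeRing c ℓ) where

  private module R = CommutativeRing R
  open FormalPowerSeries R hiding (catalan)
  open import Algebra.Properties.Monoid.Sum R.+-monoid
  open import Algebra.Properties.CommutativeMonoid.Mult R.+-commutativeMonoid using (×-distrib-+)
  open import Algebra.Properties.Semiring.Mult R.semiring
  open import Algebra.Properties.Ring R.ring using (+-cancelʳ)
  open import Relation.Binary.Reasoning.Setoid R.setoid
  open import Algebra.Solver.Ring.NaturalCoefficients.Default R.commutativeSemiring
    using (solve; _:+_; _:*_; _:=_; con)
  open PowerSeries R
  private module S = CommutativeRing commutativeRing
  open RingIdentities commutativeRing using (two; four; catalan-residue)

  -- The Euler operator x d/dx; unlike d/dx it does not shift coefficients.
  θ : Series → Series
  θ p n = n × p n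

  θ-* : ∀ p q → θ (p * q) ≋ θ p * q + p * θ q
  θ-* p q zero = solve 2 (λ p q → con 0 := (con 0 :* q :+ con 0) :+ (p :* con 0 :+ con 0)) R.refl (p 0) (q 0)
  θ-* p q (suc n) = begin
    suc n × (p 0 R.* q (suc n) R.+ y)
      ≈⟨ ×-distrib-+ _ _ (suc n) ⟩
    suc n × (p 0 R.* q (suc n)) R.+ (y R.+ n × y)
      ≈⟨ R.+-cong (R.sym (×-comm-* (suc n) _ _)) (R.+-congˡ (θ-* (tail p) q n)) ⟩
    x R.+ (y R.+ (z R.+ w))
      ≈⟨ solve 5 (λ x y z w q → x :+ (y :+ (z :+ w)) := (con 0 :* q :+ (y :+ z)) :+ (x :+ w)) R.refl x y z w (q (suc n)) ⟩
    (R.0# R.* q (suc n) R.+ (y R.+ z)) R.+ (x R.+ w)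
      ≈⟨ R.+-congʳ (R.+-congˡ (*-distribʳ-+ q (tail p) (θ (tail p)) n)) ⟨
    (θ p * q) (suc n) R.+ (p * θ q) (suc n) ∎
    where
    x = p 0 R.* (suc n × q (suc n))
    y = (tail p * q) n
    z = (θ (tail p) * q) n
    w = (tail p * θ q) n

  θ-+ : ∀ p q → θ (p + q) ≋ θ p + θ q
  θ-+ p q n = ×-distrib-+ (p n) (q n) n

  θ-1 : θ 1ₛ ≋ 0ₛ
  θ-1 zero    = R.refl
  θ-1 (suc n) = R.trans (×-congʳ (suc n) (R.sym (R.zeroˡ R.0#))) (R.trans (R.sym (×-comm-* (suc n) R.0# R.0#)) (R.zeroˡ _))

  θ-X : θ X ≋ X
  θ-X zero          = R.refl
  θ-X (suc zero)    = R.+-identityʳ _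
  θ-X (suc (suc n)) = θ-1 (suc (suc n))

  -- Coefficient n + 1 is `catalan-suc`, with 2 (2n + 1) split into 2 + 4n.
  Catalan-ode : Catalan + θ Catalan ≋ 1ₛ + X * (two Catalan + four (θ Catalan))
  Catalan-ode zero = R.+-cong (R.+-identityʳ R.1#) (R.sym (X-*-zero (two Catalan + four (θ Catalan))))
  Catalan-ode (suc n) = begin
    suc (suc n) × (catalan (suc n) × R.1#)
      ≈⟨ ×-assocˡ R.1# (suc (suc n)) (catalan (suc n)) ⟩
    (suc (suc n) ℕ.* catalan (suc n)) × R.1#
      ≈⟨ ×-congˡ (≡.trans (catalan-suc n)
           (solveℕ 2 (λ n k → conℕ 2 :*ℕ (conℕ 1 :+ℕ conℕ 2 :*ℕ n) :*ℕ k :=ℕ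
             (k :+ℕ k) :+ℕ (((n :*ℕ k) :+ℕ (n :*ℕ k)) :+ℕ ((n :*ℕ k) :+ℕ (n :*ℕ k)))) ≡.refl n k)) ⟩
    ((k ℕ.+ k) ℕ.+ ((n ℕ.* k ℕ.+ n ℕ.* k) ℕ.+ (n ℕ.* k ℕ.+ n ℕ.* k))) × R.1#
      ≈⟨ R.trans (×-homo-+ R.1# (k ℕ.+ k) _) (R.+-cong (double k)
           (R.trans (double (n ℕ.* k ℕ.+ n ℕ.* k)) (R.+-cong 2nk 2nk))) ⟩
    (two Catalan + four (θ Catalan)) n
      ≈⟨ R.trans (R.+-identityˡ _) (X-*-suc (two Catalan + four (θ Catalan)) n) ⟨
    R.0# R.+ (X * (two Catalan + four (θ Catalan))) (suc n) ∎
    where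
    open ℕ-Solver.+-*-Solver using () renaming (solve to solveℕ; con to conℕ; _:+_ to _:+ℕ_; _:*_ to _:*ℕ_; _:=_ to _:=ℕ_)
    k = catalan n
    double : ∀ m → (m ℕ.+ m) × R.1# R.≈ m × R.1# R.+ m × R.1#
    double m = ×-homo-+ R.1# m m
    2nk : (n ℕ.* k ℕ.+ n ℕ.* k) × R.1# R.≈ θ Catalan n R.+ θ Catalan n
    2nk = R.trans (double (n ℕ.* k)) (R.sym (R.+-cong (×-assocˡ R.1# n k) (×-assocˡ R.1# n k)))

  -- The differential equation determines coefficient n + 1 only through its (n + 2)-fold multiple,
  -- which has to be cancelled.
  TorsionFree : Set _
  TorsionFree = ∀ n {x y} → suc n × x R.≈ suc n × y → x R.≈ y

  Catalan-equation-torsionFree : TorsionFree → 1ₛ + X * (Catalan * Catalan) ≋ Catalan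
  Catalan-equation-torsionFree cancel = go
    where
    G = 1ₛ + X * (Catalan * Catalan)
    T = θ Catalan
    θG≋ : θ G ≋ X * (Catalan * Catalan) + X * (T * Catalan + Catalan * T)
    θG≋ = S.trans (θ-+ 1ₛ (X * (Catalan * Catalan)))
      (S.trans (S.+-cong {θ 1ₛ} θ-1 (θ-* X (Catalan * Catalan)))
      (S.trans (S.+-identityˡ _)
        (S.+-cong (S.*-congʳ {Catalan * Catalan} θ-X) (S.*-congˡ {X} (θ-* Catalan Catalan)))))
    residue : (G + θ G) + X * four T ≋ (Catalan + T) + X * four (θ G)
    residue = catalan-residue X Catalan T {G} {θ G} Catalan-ode S.refl θG≋
    go : G ≋ Catalan
    go zero = R.+-congˡ (X-*-zero (Catalan * Catalan))
    -- In coefficient n + 1 of `residue` the terms multiplied by X are taken at index n, where the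
    -- induction hypothesis identifies `θ G` with `T`. What remains is an equality of (n + 2)-fold
    -- multiples.
    go (suc n) = cancel (suc n) (+-cancelʳ (four T n) (suc (suc n) × G (suc n)) (suc (suc n) × Catalan (suc n)) (begin
      suc (suc n) × G (suc n) R.+ four T n
        ≈⟨ R.+-congˡ (X-*-suc (four T) n) ⟨
      suc (suc n) × G (suc n) R.+ (X * four T) (suc n)
        ≈⟨ residue (suc n) ⟩
      suc (suc n) × Catalan (suc n) R.+ (X * four (θ G)) (suc n)
        ≈⟨ R.+-congˡ (X-*-suc (four (θ G)) n) ⟩
      suc (suc n) × Catalan (suc n) R.+ four (θ G) n
        ≈⟨ R.+-congˡ (R.+-cong (R.+-cong θGn θGn) (R.+-cong θGn θGn)) ⟩
      suc (suc n) × Catalan (suc n) R.+ four T n ∎))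
      where
      θGn : θ G n R.≈ T n
      θGn = ×-congʳ n (go n)

  ×1-homo-sum : ∀ m (f : Fin m → ℕ) → ℕ-Sum.sum f × R.1# R.≈ ∑[ i < m ] (f i × R.1#)
  ×1-homo-sum zero    f = R.refl
  ×1-homo-sum (suc m) f = R.trans (×-homo-+ R.1# (f fzero) _) (R.+-congˡ (×1-homo-sum m (f ∘ fsuc)))

  Catalan² : ∀ n → (Catalan * Catalan) n R.≈ segner n × R.1#
  Catalan² n = R.sym (R.trans (×1-homo-sum (suc n) (λ i → catalan (toℕ i) ℕ.* catalan (n ∸ toℕ i)))
    (sum-cong-≋ {suc n} λ i → ×1-homo-* (catalan (toℕ i)) (catalan (n ∸ toℕ i))))

-- Transfer of the Catalan convolution from the integers to the naturals.

module _ where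
  open import Algebra.Properties.Semiring.Mult ℤₚ.+-*-semiring
  open CatalanSeries ℤₚ.+-*-commutativeRing
  open PowerSeries ℤₚ.+-*-commutativeRing
  open FormalPowerSeries ℤₚ.+-*-commutativeRing using (Catalan)

  ×≡* : ∀ n x → n × x ≡ ℤ.+ n ℤ.* x
  ×≡* zero    x = ≡.sym (ℤₚ.*-zeroˡ x)
  ×≡* (suc n) x = ≡.trans (≡.cong (λ y → x ℤ.+ y) (×≡* n x)) (≡.sym (ℤₚ.suc-* (ℤ.+ n) x))

  ℤ-torsionFree : TorsionFree
  ℤ-torsionFree n {x} {y} h = ℤₚ.*-cancelˡ-≡ (ℤ.+ suc n) x y
    (≡.trans (≡.sym (×≡* (suc n) x)) (≡.trans h (×≡* (suc n) y)))

  ×1-injective : ∀ {m n} → m × ℤ.1ℤ ≡ n × ℤ.1ℤ → m ≡ n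
  ×1-injective {m} {n} h = ℤₚ.+-injective (≡.trans (≡.sym (×1≡+ m)) (≡.trans h (×1≡+ n)))
    where
    ×1≡+ : ∀ n → n × ℤ.1ℤ ≡ ℤ.+ n
    ×1≡+ n = ≡.trans (×≡* n ℤ.1ℤ) (ℤₚ.*-identityʳ (ℤ.+ n))

  -- Both sides are compared as multiples of 1 in ℤ, where the series equation is available and n ↦
  -- n × 1 is injective.
  catalan≡segner : ∀ n → catalan (suc n) ≡ segner n
  catalan≡segner n = ×1-injective (begin
    Catalan (suc n)                            ≡⟨ Catalan-equation-torsionFree ℤ-torsionFree (suc n) ⟨
    ℤ.0ℤ ℤ.+ (X * (Catalan * Catalan)) (suc n) ≡⟨ ℤₚ.+-identityˡ _ ⟩
    (X * (Catalan * Catalan)) (suc n)          ≡⟨ X-*-suc (Catalan * Catalan) n ⟩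
    (Catalan * Catalan) n                      ≡⟨ Catalan² n ⟩
    segner n × ℤ.1ℤ                            ∎)
    where
    open FormalPowerSeries ℤₚ.+-*-commutativeRing using (X; _*_)
    open ≡.≡-Reasoning

open import Data.Product using (_×_)

-- Bell arrays with a rational B-sequence.

module RationalBSequence {c ℓ} (R : CommutativeRing c ℓ) where

  private module R = CommutativeRing R
  open FormalPowerSeries R hiding (catalan)
  open PowerSeries R
  open CatalanSeries R using (Catalan²)
  private module S = CommutativeRing commutativeRing
  open RingIdentities commutativeRing
  open import Algebra.Properties.Monoid.Sum R.+-monoid
  open import Algebra.Properties.Semiring.Mult R.semiring using (×-congˡ)

  -- Torsion is harmless here: every coefficient is the image of an identity between natural
  -- numbers.
  Catalan-equation : Catalan ≋ 1ₛ + X * (Catalan * Catalan)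
  Catalan-equation zero    = R.+-congˡ (R.sym (X-*-zero (Catalan * Catalan)))
  Catalan-equation (suc n) = begin
    Catalan (suc n)                                ≈⟨ ×-congˡ (catalan≡segner n) ⟩
    _                                              ≈⟨ Catalan² n ⟨
    (Catalan * Catalan) n                          ≈⟨ X-*-suc (Catalan * Catalan) n ⟨
    (X * (Catalan * Catalan)) (suc n)              ≈⟨ R.+-identityˡ _ ⟨
    R.0# R.+ (X * (Catalan * Catalan)) (suc n)     ∎
    where open import Relation.Binary.Reasoning.Setoid R.setoid

  -- In column 0 the entry at (n - j, j) is coefficient n - j of g f^j, which is coefficient n of g
  -- (x f)^j. The recurrence therefore sums to g times β composed with x f.
  bSequence-equation : ∀ g β → g 0 R.≈ R.1# → IsBSequence (bell g) β →
                       g ≋ 1ₛ + X * (g * β ⟨ X * (X * g) ⟩)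
  bSequence-equation g β g₀≈1 isB zero =
    R.trans g₀≈1 (R.sym (R.trans (R.+-congˡ (X-*-zero (g * β ⟨ X * (X * g) ⟩))) (R.+-identityʳ _)))
  bSequence-equation g β g₀≈1 isB (suc n) = begin
    g (suc n)                                 ≈⟨ S.*-identityʳ g (suc n) ⟨
    (g * 1ₛ) (suc n)                          ≈⟨ isB n 0 ⟩
    R.0# R.+ ∑[ j ≤ n ] (β (toℕ j) R.* (g * f ^ toℕ j) (n ∸ toℕ j))
      ≈⟨ R.+-congˡ (sum-cong-≋ {suc n} λ j → R.*-congˡ {β (toℕ j)} (shifted j)) ⟨
    R.0# R.+ ∑[ j ≤ n ] (β (toℕ j) R.* (g * z ^ toℕ j) n)
      ≈⟨ R.+-congˡ (*-distribˡ-∑ g (suc n) (λ j → β (toℕ j)) (λ j → z ^ toℕ j) n) ⟨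
    R.0# R.+ (g * truncated n β) n
      -- Coefficient n of a product with g sees only coefficients up to n, where the truncation
      -- agrees with the composite.
      ≈⟨ R.+-congˡ (*-cong-≤ n {truncated n β} {β ⟨ z ⟩} g
            λ m m≤n → truncated-stable n m β m≤n ℕₚ.≤-refl) ⟩
    R.0# R.+ (g * β ⟨ z ⟩) n                  ≈⟨ R.+-congˡ (X-*-suc (g * β ⟨ z ⟩) n) ⟨
    R.0# R.+ (X * (g * β ⟨ z ⟩)) (suc n)      ∎
    where
    open import Relation.Binary.Reasoning.Setoid R.setoid
    f z : Series
    f = X * g
    z = X * f
    open Composition z (X-*-zero f)
    open import Algebra.Properties.CommutativeSemigroup S.*-commutativeSemigroup using (x∙yz≈y∙xz)
    shifted : ∀ j → (g * z ^ toℕ j) n R.≈ (g * f ^ toℕ j) (n ∸ toℕ j)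
    shifted j = R.trans
      (S.trans (S.*-congˡ {g} (*-^ X f (toℕ j))) (x∙yz≈y∙xz g (X ^ toℕ j) (f ^ toℕ j)) n)
      (X^-* (g * f ^ toℕ j) (ℕₚ.≤-pred (Finₚ.toℕ<n j)))

  open import Relation.Binary.Reasoning.Setoid S.setoid

  Catalan⟨⟩-equation : ∀ y → y 0 R.≈ R.0# →
                       Catalan ⟨ y ⟩ ≋ 1ₛ + y * (Catalan ⟨ y ⟩ * Catalan ⟨ y ⟩)
  Catalan⟨⟩-equation y y₀≈0 = begin
    Catalan ⟨ y ⟩
      ≈⟨ ⟨⟩-cong y Catalan-equation ⟩
    (1ₛ + X * (Catalan * Catalan)) ⟨ y ⟩
      ≈⟨ ⟨⟩-+ y 1ₛ (X * (Catalan * Catalan)) ⟩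
    1ₛ ⟨ y ⟩ + (X * (Catalan * Catalan)) ⟨ y ⟩
      ≈⟨ S.+-cong (⟨⟩-const R.1#) (S.trans (⟨⟩-* X (Catalan * Catalan))
           (S.*-cong ⟨⟩-X (⟨⟩-* Catalan Catalan))) ⟩
    1ₛ + y * (Catalan ⟨ y ⟩ * Catalan ⟨ y ⟩) ∎
    where open Composition y y₀≈0

  /-*-cancel : ∀ p d → d 0 R.≈ R.1# → p / d * d ≋ p
  /-*-cancel p d d₀≈1 = S.trans (S.*-assoc p (1/ d) d) (S.trans
    (S.*-congˡ {p} (S.trans (S.*-comm (1/ d) d) (*-inverseʳ d d₀≈1))) (S.*-identityʳ p))

  [p-q]+q≋p : ∀ p q → (p - q) + q ≋ p
  [p-q]+q≋p p q = S.trans (S.+-assoc p (- q) q) (S.trans (S.+-congˡ {p} (S.-‿inverseˡ q)) (S.+-identityʳ p))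

  X^2≋X*X : X ^ 2 ≋ X * X
  X^2≋X*X = S.*-congˡ {X} (S.*-identityʳ X)

  ∙-X^2 : ∀ b → b ∙ X ^ 2 ≋ const b * (X * X)
  ∙-X^2 b = S.trans (S.sym (const-* b (X ^ 2))) (S.*-congˡ {const b} X^2≋X*X)

  +-constant : ∀ {x y z} → x R.≈ z → y R.≈ R.0# → x R.+ y R.≈ z
  +-constant x≈z y≈0 = R.trans (R.+-cong x≈z y≈0) (R.+-identityʳ _)

  -‿constant : ∀ {x} → x R.≈ R.0# → R.- x R.≈ R.0#
  -‿constant x≈0 = R.trans (R.-‿cong x≈0) (R.trans (R.sym (R.+-identityˡ _)) (R.-‿inverseʳ R.0#))

  ∙-constant : ∀ a p → p 0 R.≈ R.0# → (a ∙ p) 0 R.≈ R.0#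
  ∙-constant a p p₀≈0 = R.trans (R.*-congˡ p₀≈0) (R.zeroʳ a)

  *-constantˡ : ∀ p q → p 0 R.≈ R.0# → (p * q) 0 R.≈ R.0#
  *-constantˡ p q p₀≈0 = R.trans (R.+-identityʳ _) (R.trans (R.*-congʳ p₀≈0) (R.zeroˡ _))

  *-constantʳ : ∀ p q → q 0 R.≈ R.0# → (p * q) 0 R.≈ R.0#
  *-constantʳ p q q₀≈0 = R.trans (S.*-comm p q 0) (*-constantˡ q p q₀≈0)

  *-constant-1 : ∀ p q → p 0 R.≈ R.1# → q 0 R.≈ R.1# → (p * q) 0 R.≈ R.1#
  *-constant-1 p q p₀≈1 q₀≈1 = R.trans (R.+-identityʳ _) (R.trans (R.*-cong p₀≈1 q₀≈1) (R.*-identityˡ R.1#))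

  -- Closed forms for given parameters.

  module _ (a b c : R.Carrier) (g : Series) (g₀≈1 : g 0 R.≈ R.1#)
           (isB : IsBSequence (bell g) ((const a - c ∙ X) / (1ₛ + b ∙ X))) where

    private
      ā b̄ c̄ β u D E W : Series
      ā = const a
      b̄ = const b
      c̄ = const c
      β = (ā - c ∙ X) / (1ₛ + b ∙ X)
      u = (a R.* b R.+ c) ∙ X ^ 3
      D = 1ₛ + a ∙ X + b ∙ X ^ 2
      E = 1ₛ - a ∙ X - b ∙ X ^ 2
      W = X ^ 2 * (b̄ + c ∙ X)

      D₀≈1 : D 0 R.≈ R.1#
      D₀≈1 = +-constant (+-constant R.refl (∙-constant a X R.refl)) (∙-constant b (X ^ 2) (X-*-zero (X ^ 1)))

      E₀≈1 : E 0 R.≈ R.1#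
      E₀≈1 = +-constant (+-constant R.refl (-‿constant (∙-constant a X R.refl)))
        (-‿constant (∙-constant b (X ^ 2) (X-*-zero (X ^ 1))))

      u₀≈0 : u 0 R.≈ R.0#
      u₀≈0 = ∙-constant (a R.* b R.+ c) (X ^ 3) (X-*-zero (X ^ 2))

      W₀≈0 : W 0 R.≈ R.0#
      W₀≈0 = *-constantˡ (X ^ 2) (b̄ + c ∙ X) (X-*-zero (X ^ 1))

      E-split : E + (ā * X + b̄ * (X * X)) ≋ 1ₛ
      E-split = begin
        E + (ā * X + b̄ * (X * X))
          ≈⟨ S.+-congˡ {E} (S.+-cong (const-* a X) (S.sym (∙-X^2 b))) ⟩
        E + (a ∙ X + b ∙ X ^ 2)
          ≈⟨ S.+-congˡ {E} (S.+-comm (a ∙ X) (b ∙ X ^ 2)) ⟩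
        E + (b ∙ X ^ 2 + a ∙ X)
          ≈⟨ S.+-assoc E (b ∙ X ^ 2) (a ∙ X) ⟨
        E + b ∙ X ^ 2 + a ∙ X
          ≈⟨ S.+-congʳ {a ∙ X} ([p-q]+q≋p (1ₛ - a ∙ X) (b ∙ X ^ 2)) ⟩
        1ₛ - a ∙ X + a ∙ X
          ≈⟨ [p-q]+q≋p 1ₛ (a ∙ X) ⟩
        1ₛ ∎

      W≋ : W ≋ X * X * (b̄ + c̄ * X)
      W≋ = S.*-cong X^2≋X*X (S.+-congˡ {b̄} (S.sym (const-* c X)))

      β-equation : β * (1ₛ + b ∙ X) + c ∙ X ≋ ā
      β-equation = S.trans
        (S.+-congʳ {c ∙ X} (/-*-cancel (ā - c ∙ X) (1ₛ + b ∙ X) (+-constant R.refl (∙-constant b X R.refl))))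
        ([p-q]+q≋p ā (c ∙ X))

    g-equation : g + (b̄ * ((X * g) * (X * g)) + c̄ * (X * ((X * g) * (X * g)))) ≋
                 1ₛ + (b̄ * (X * (X * g)) + ā * (X * g))
    g-equation = bell-equation ā b̄ c̄ X g (β ⟨ z ⟩) substituted (bSequence-equation g β g₀≈1 isB)
      where
      z = X * (X * g)
      open Composition z (X-*-zero (X * g))
      ∙X⟨z⟩ : ∀ r → (r ∙ X) ⟨ z ⟩ ≋ const r * z
      ∙X⟨z⟩ r = S.trans (⟨⟩-∙ z r X) (S.trans (λ n → R.*-congˡ (⟨⟩-X n)) (S.sym (const-* r z)))
      -- The quotient itself is never composed termwise: its relation with the denominator cleared,
      -- `β-equation`, is composed with z.
      substituted : β ⟨ z ⟩ * (1ₛ + b̄ * z) + c̄ * z ≋ ā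
      substituted = begin
        β ⟨ z ⟩ * (1ₛ + b̄ * z) + c̄ * z
          ≈⟨ S.+-cong (S.*-congˡ {β ⟨ z ⟩} (S.+-cong (⟨⟩-const R.1#) (∙X⟨z⟩ b))) (∙X⟨z⟩ c) ⟨
        β ⟨ z ⟩ * (1ₛ ⟨ z ⟩ + (b ∙ X) ⟨ z ⟩) + (c ∙ X) ⟨ z ⟩
          ≈⟨ S.+-congʳ {(c ∙ X) ⟨ z ⟩} (S.*-congˡ {β ⟨ z ⟩} (⟨⟩-+ z 1ₛ (b ∙ X))) ⟨
        β ⟨ z ⟩ * (1ₛ + b ∙ X) ⟨ z ⟩ + (c ∙ X) ⟨ z ⟩
          ≈⟨ S.+-congʳ {(c ∙ X) ⟨ z ⟩} (⟨⟩-* β (1ₛ + b ∙ X)) ⟨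
        (β * (1ₛ + b ∙ X)) ⟨ z ⟩ + (c ∙ X) ⟨ z ⟩
          ≈⟨ ⟨⟩-+ z (β * (1ₛ + b ∙ X)) (c ∙ X) ⟨
        (β * (1ₛ + b ∙ X) + c ∙ X) ⟨ z ⟩
          ≈⟨ ⟨⟩-cong z β-equation ⟩
        ā ⟨ z ⟩
          ≈⟨ ⟨⟩-const a ⟩
        ā ∎

    g-closed-form : g ≋ (1ₛ / E) * Catalan ⟨ (- W) / E ^ 2 ⟩
    g-closed-form = quadratic-unique E W g g′
      -- `E` has constant term 1 and `W` has none, so the sum is a unit whatever g and g′ are.
      (*-inverseʳ (E + W * (g + g′)) (+-constant E₀≈1 (*-constantˡ W (g + g′) W₀≈0)))
      (S.trans g-root (S.sym g′-root))
      where
      y = (- W) / E ^ 2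
      g′ = (1ₛ / E) * Catalan ⟨ y ⟩
      y₀≈0 : y 0 R.≈ R.0#
      y₀≈0 = *-constantˡ (- W) (1/ (E ^ 2)) (-‿constant W₀≈0)
      yE²+W≋0 : y * (E * E) + W * 1ₛ ≋ 0ₛ
      yE²+W≋0 = begin
        y * (E * E) + W * 1ₛ  ≈⟨ S.+-cong (S.*-congˡ {y} (S.*-congˡ {E} (S.sym (S.*-identityʳ E)))) (S.*-identityʳ W) ⟩
        y * E ^ 2 + W         ≈⟨ S.+-congʳ {W} (/-*-cancel (- W) (E ^ 2) (*-constant-1 E (E ^ 1) E₀≈1 (R.trans (S.*-identityʳ E 0) E₀≈1))) ⟩
        - W + W               ≈⟨ S.-‿inverseˡ W ⟩
        0ₛ                    ∎
      g′-root : E * g′ + W * (g′ * g′) ≋ 1ₛ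
      g′-root = catalan-root E W 1ₛ {y = y} (*-inverseʳ E E₀≈1) yE²+W≋0 (Catalan⟨⟩-equation y y₀≈0)
      g-root : E * g + W * (g * g) ≋ 1ₛ
      g-root = S.trans (S.+-congˡ {E * g} (S.*-congʳ {g * g} W≋))
        (bell-quadratic ā b̄ c̄ X g E g-equation E-split)

    A-closed-form : ∀ {A} → IsASequence (bell g) A →
                    A ≋ 1ₛ + a ∙ X - (u / D) * Catalan ⟨ u / D ^ 2 ⟩
    A-closed-form {A} (f̄ , isInverse , Af̄≋X) =
      S.trans A≋P-v (S.+-congˡ {P} (S.-‿cong v≋v′))
      where
      open IsCompositionalInverse isInverse
      open Composition f̄ f̄₀≈0
      P v y v′ γ : Series
      P  = 1ₛ + a ∙ X
      v  = P - A
      y  = u / D ^ 2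
      v′ = (u / D) * Catalan ⟨ y ⟩
      γ  = g ⟨ f̄ ⟩

      f̄γ≋X : f̄ * γ ≋ X
      f̄γ≋X = S.trans (S.*-congʳ {γ} (S.sym ⟨⟩-X)) (S.trans (S.sym (⟨⟩-* X g)) inverseʳ)

      -- The product A f̄ γ is evaluated in two ways, by f̄ γ = x and by A f̄ = x, and then x is
      -- cancelled.
      A≋γ : A ≋ γ
      A≋γ = X-*-cancel A γ (begin
        X * A        ≈⟨ S.*-comm X A ⟩
        A * X        ≈⟨ S.*-congˡ {A} f̄γ≋X ⟨
        A * (f̄ * γ)  ≈⟨ S.*-assoc A f̄ γ ⟨
        A * f̄ * γ    ≈⟨ S.*-congʳ {γ} Af̄≋X ⟩
        X * γ        ∎)

      A₀≈1 : A 0 R.≈ R.1#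
      A₀≈1 = R.trans (A≋γ 0) (R.trans (truncated-0 0 g) g₀≈1)

      v+A≋ : v + A ≋ 1ₛ + ā * X
      v+A≋ = S.trans ([p-q]+q≋p P A) (S.+-congˡ {1ₛ} (S.sym (const-* a X)))

      A≋P-v : A ≋ P - v
      A≋P-v = begin
        A             ≈⟨ S.+-identityʳ A ⟨
        A + 0ₛ        ≈⟨ S.+-congˡ {A} (S.-‿inverseʳ v) ⟨
        A + (v - v)   ≈⟨ S.+-assoc A v (- v) ⟨
        A + v - v     ≈⟨ S.+-congʳ { - v} (S.trans (S.+-comm A v) ([p-q]+q≋p P A)) ⟩
        P - v         ∎

      const*⟨f̄⟩ : ∀ r p q → p ⟨ f̄ ⟩ ≋ q → (const r * p) ⟨ f̄ ⟩ ≋ const r * q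
      const*⟨f̄⟩ r p q h = S.trans (⟨⟩-* (const r) p) (S.*-cong (⟨⟩-const r) h)

      f f² : Series
      f  = X * g
      f² = f * f

      f²⟨f̄⟩ : f² ⟨ f̄ ⟩ ≋ X * X
      f²⟨f̄⟩ = S.trans (⟨⟩-* f f) (S.*-cong inverseʳ inverseʳ)

      -- Under f̄ each block X * g of `g-equation` collapses to X, and only the factors X outside
      -- such blocks become f̄. Every term has at most one of these.
      A-equation : A + (b̄ * (X * X) + c̄ * (f̄ * (X * X))) ≋ 1ₛ + (b̄ * (f̄ * X) + ā * X)
      A-equation = begin
        A + (b̄ * (X * X) + c̄ * (f̄ * (X * X)))
          ≈⟨ S.+-cong A≋γ (S.sym (S.trans (⟨⟩-+ f̄ (b̄ * f²) (c̄ * (X * f²)))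
               (S.+-cong (const*⟨f̄⟩ b f² (X * X) f²⟨f̄⟩)
                 (const*⟨f̄⟩ c (X * f²) (f̄ * (X * X)) (S.trans (⟨⟩-* X f²) (S.*-cong ⟨⟩-X f²⟨f̄⟩)))))) ⟩
        γ + (b̄ * f² + c̄ * (X * f²)) ⟨ f̄ ⟩
          ≈⟨ ⟨⟩-+ f̄ g (b̄ * f² + c̄ * (X * f²)) ⟨
        (g + (b̄ * f² + c̄ * (X * f²))) ⟨ f̄ ⟩
          ≈⟨ ⟨⟩-cong f̄ g-equation ⟩
        (1ₛ + (b̄ * (X * f) + ā * f)) ⟨ f̄ ⟩
          ≈⟨ ⟨⟩-+ f̄ 1ₛ (b̄ * (X * f) + ā * f) ⟩
        1ₛ ⟨ f̄ ⟩ + (b̄ * (X * f) + ā * f) ⟨ f̄ ⟩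
          ≈⟨ S.+-cong (⟨⟩-const R.1#) (S.trans (⟨⟩-+ f̄ (b̄ * (X * f)) (ā * f))
               (S.+-cong (const*⟨f̄⟩ b (X * f) (f̄ * X) (S.trans (⟨⟩-* X f) (S.*-cong ⟨⟩-X inverseʳ)))
                 (const*⟨f̄⟩ a f X inverseʳ))) ⟩
        1ₛ + (b̄ * (f̄ * X) + ā * X) ∎

      D≋ : D ≋ 1ₛ + ā * X + b̄ * (X * X)
      D≋ = S.+-cong (S.+-congˡ {1ₛ} (S.sym (const-* a X))) (∙-X^2 b)

      u≋ : u ≋ (ā * b̄ + c̄) * (X * (X * X))
      u≋ = S.trans (S.sym (const-* (a R.* b R.+ c) (X ^ 3)))
        (S.*-cong (S.trans (const-+-const (a R.* b) c) (S.+-congʳ {c̄} (const-*-const a b)))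
          (S.*-congˡ {X} X^2≋X*X))

      v-root : D * v + - 1ₛ * (v * v) ≋ u
      v-root = S.trans (S.+-congʳ { - 1ₛ * (v * v)} (S.*-congʳ {v} D≋))
        (S.trans (A-quadratic ā b̄ c̄ X f̄ A v A-equation (S.trans (S.*-congˡ {f̄} A≋γ) f̄γ≋X) v+A≋) (S.sym u≋))

      yD²-u≋0 : y * (D * D) + - 1ₛ * u ≋ 0ₛ
      yD²-u≋0 = begin
        y * (D * D) + - 1ₛ * u  ≈⟨ S.+-cong (S.*-congˡ {y} (S.*-congˡ {D} (S.sym (S.*-identityʳ D)))) (-1*x≈-x u) ⟩
        y * D ^ 2 - u           ≈⟨ S.+-congʳ { - u} (/-*-cancel u (D ^ 2) (*-constant-1 D (D ^ 1) D₀≈1 (R.trans (S.*-identityʳ D 0) D₀≈1))) ⟩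
        u - u                   ≈⟨ S.-‿inverseʳ u ⟩
        0ₛ                      ∎
        where open import Algebra.Properties.Ring S.ring using (-1*x≈-x)

      v′-root : D * v′ + - 1ₛ * (v′ * v′) ≋ u
      v′-root = catalan-root D (- 1ₛ) u {y = y} (*-inverseʳ D D₀≈1) yD²-u≋0
        (Catalan⟨⟩-equation y (*-constantˡ u (1/ (D ^ 2)) u₀≈0))

      v₀≈0 : v 0 R.≈ R.0#
      v₀≈0 = R.trans (R.+-cong (+-constant R.refl (∙-constant a X R.refl)) (R.-‿cong A₀≈1)) (R.-‿inverseʳ R.1#)

      v′₀≈0 : v′ 0 R.≈ R.0#
      v′₀≈0 = *-constantˡ (u / D) (Catalan ⟨ y ⟩) (*-constantˡ u (1/ D) u₀≈0)

      v≋v′ : v ≋ v′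
      -- The vanishing constant terms of v and v′ select the same root: D - (v + v′) then has
      -- constant term 1 and is a unit.
      v≋v′ = quadratic-unique D (- 1ₛ) v v′
        (*-inverseʳ (D + - 1ₛ * (v + v′)) (+-constant D₀≈1 (*-constantʳ (- 1ₛ) (v + v′) (+-constant v₀≈0 v′₀≈0))))
        (S.trans v-root (S.sym v′-root))

  -- At ℂ, conversion checking of the closed forms unfolds all complex arithmetic as
  -- soon as they are written with another copy of the operations than the one opened
  -- by Defs.  So the operations are variables here, which a signature mentioning
  -- those of Defs instantiates, and only single operations are compared.
  data SameOperations : (1′ X′ Catalan′ : Series) (const′ : R.Carrier → Series)
    (neg : Series → Series) (_∙′_ : R.Carrier → Series → Series) (_^′_ : Series → ℕ → Series)
    (_+′_ _-′_ _*′_ _/′_ _⟨_⟩′ : Series → Series → Series)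
    (_≋′_ : Series → Series → Set ℓ) → Set where
    same : SameOperations 1ₛ X Catalan const -_ _∙_ _^_ _+_ _-_ _*_ _/_ _⟨_⟩ _≋_

  -- The variables `P` and `m` abstract, in the same spirit, the B-sequence property and the scalar
  -- ab + c.
  closed-forms :
    ∀ {1′ X′ Catalan′ const′ neg _∙′_ _^′_ _+′_ _-′_ _*′_ _/′_ _⟨_⟩′ _≋′_} →
    SameOperations 1′ X′ Catalan′ const′ neg _∙′_ _^′_ _+′_ _-′_ _*′_ _/′_ _⟨_⟩′ _≋′_ →
    ∀ {g} {P : Series → Set ℓ} → (∀ β → P β → IsBSequence (bell g) β) →
    ∀ {a b c m A} → m ≡ a R.* b R.+ c → g 0 R.≈ R.1# →
    P ((const′ a -′ (c ∙′ X′)) /′ (1′ +′ (b ∙′ X′))) →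
    IsASequence (bell g) A →
    let u = m ∙′ (X′ ^′ 3)
        D = (1′ +′ (a ∙′ X′)) +′ (b ∙′ (X′ ^′ 2))
        E = (1′ -′ (a ∙′ X′)) -′ (b ∙′ (X′ ^′ 2))
    in (A ≋′ ((1′ +′ (a ∙′ X′)) -′ ((u /′ D) *′ (Catalan′ ⟨ u /′ (D ^′ 2) ⟩′)))) ×
       (g ≋′ ((1′ /′ E) *′ (Catalan′ ⟨ neg ((X′ ^′ 2) *′ (const′ b +′ (c ∙′ X′))) /′ (E ^′ 2) ⟩′)))
  closed-forms same {g} P⇒B {a} {b} {c} ≡.refl g₀≈1 isP isA =
    A-closed-form a b c g g₀≈1 (P⇒B _ isP) isA , g-closed-form a b c g g₀≈1 (P⇒B _ isP)

-- Specialization to complex coefficients.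

open import Defs

proposition2 :
    (a b c : ℂ) (g A : Series) →
    IsBellPseudoInvolution g →
    IsBSequence (bell g) ((const a - c ∙ X) / (1ₛ + b ∙ X)) →
    IsASequence (bell g) A →
    let u = ((a Complex.* b) Complex.+ c) ∙ X ^ 3
        D = 1ₛ + a ∙ X + b ∙ X ^ 2
        E = 1ₛ - a ∙ X - b ∙ X ^ 2
    in (A ≋ 1ₛ + a ∙ X - (u / D) * Catalan ⟨ u / D ^ 2 ⟩)
       × (g ≋ (1ₛ / E) * Catalan ⟨ (- (X ^ 2 * (const b + c ∙ X))) / E ^ 2 ⟩)
proposition2 a b c g A isBell isB isA =
  closed-forms operations {g} isB⇒isB {a} {b} {c} {(a Complex.* b) Complex.+ c} {A} ≡.refl g₀≈1 isB isA
  where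
  open IsBellPseudoInvolution isBell using (g₀≈1)
  open RationalBSequence Complex.commutativeRing
  operations : SameOperations 1ₛ X Catalan const -_ _∙_ _^_ _+_ _-_ _*_ _/_ _⟨_⟩ _≋_
  operations = same
  -- The signature of this identity map fixes the predicate `P`.
  isB⇒isB : ∀ β → IsBSequence (bell g) β → IsBSequence (bell g) β
  isB⇒isB β isB = isB
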